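{- For all integers $k\ge0$, $|A_{\mathbb{Z}[i],2k+1}|=14\cdot 4^{k+1}-34\cdot 2^{k+1}+8k+29$. For all integers $k\ge1$, $|A_{\mathbb{Z}[i],2k}|=28\cdot 4^{k}-48\cdot 2^{k}+8k+25$.
   Context: For $M\subseteq\mathbb{Z}[i]$ and $\beta\in\mathbb{Z}[i]$, write $M\twoheadrightarrow \mathbb{Z}[i]/\beta$ if every residue class of $\mathbb{Z}[i]/(\beta)$ has a representative in $M$. The Motzkin sets of $\mathbb{Z}[i]$ are $A_{\mathbb{Z}[i],0}=\{0,\pm1,\pm i\}$ and, for $j\ge1$, $A_{\mathbb{Z}[i],j}=A_{\mathbb{Z}[i],j-1}\cup\{\beta\in\mathbb{Z}[i]: A_{\mathbb{Z}[i],j-1}\twoheadrightarrow\mathbb{Z}[i]/\beta\}$. -}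

module Defs where

open import Data.Integer using (ℤ; +_; -_; _+_; _-_; _*_; 0ℤ; 1ℤ; -1ℤ)
open import Data.Nat using (ℕ; zero; suc)
open import Data.Product using (_×_; _,_; Σ; ∃; ∃-syntax)
open import Data.Sum using (_⊎_)
open import Data.List using (List; length)
open import Data.List.Membership.Propositional using (_∈_)
open import Data.List.Relation.Unary.Unique.Propositional using (Unique)
open import Function.Bundles using (_⇔_)
open import Relation.Binary.PropositionalEquality using (_≡_)

record ℤ[i] : Set where
  constructor _+_i
  field
    re : ℤ
    im : ℤ
open ℤ[i] public

_-ᵍ_ : ℤ[i] → ℤ[i] → ℤ[i]
(a + b i) -ᵍ (c + d i) = (a - c) + (b - d) i

_*ᵍ_ : ℤ[i] → ℤ[i] → ℤ[i]
(a + b i) *ᵍ (c + d i) = (a * c - b * d) + (a * d + b * c) i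

_∣ᵍ_ : ℤ[i] → ℤ[i] → Set
β ∣ᵍ α = ∃[ γ ] (α ≡ β *ᵍ γ)

_≡_[modᵍ_] : ℤ[i] → ℤ[i] → ℤ[i] → Set
α ≡ α' [modᵍ β ] = β ∣ᵍ (α -ᵍ α')

_↠mod_ : (ℤ[i] → Set) → ℤ[i] → Set
M ↠mod β = ∀ (α : ℤ[i]) → ∃[ m ] (M m × α ≡ m [modᵍ β ])

A₀ : ℤ[i] → Set
A₀ β = (β ≡ 0ℤ + 0ℤ i) ⊎ (β ≡ 1ℤ + 0ℤ i) ⊎ (β ≡ -1ℤ + 0ℤ i)
     ⊎ (β ≡ 0ℤ + 1ℤ i) ⊎ (β ≡ 0ℤ + -1ℤ i)

Motzkin : ℕ → ℤ[i] → Set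
Motzkin zero β = A₀ β
Motzkin (suc j) β = Motzkin j β ⊎ (Motzkin j ↠mod β)

HasCard : (ℤ[i] → Set) → ℕ → Set
HasCard P n = Σ (List ℤ[i]) λ xs →
  Unique xs × (∀ x → (x ∈ xs) ⇔ P x) × length xs ≡ n

{-# OPTIONS --safe #-}

-- Write θ for multiplication by 1 + i. The Motzkin set A n turns out to be the set G n of all θᵐ z
-- with m ≤ n, where z is 0 or an odd element (1 + i ∤ z) of the octagon |x|, |y| ≤ w (n - m) - 2,
-- |x| + |y| ≤ w (n - m + 1) - 3, with w (2 k) = 3 · 2ᵏ and w (2 k + 1) = 4 · 2ᵏ. Two facts give this.
--
-- If G n represents all classes mod β, then β divides (1 + i)ⁿ⁺¹ - m for some m in G n. This is a
-- nonzero element of G (n + 1), and G (n + 1) is closed under taking divisors, by comparing norms.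
--
-- If β = θ η lies in G (n + 1), a representative m mod η yields the representatives θ m and θ m + 1
-- mod β. If β is odd, every class has a representative ζ in the square with vertices ±β(1 ± i)/2,
-- which lies inside the octagon for n. The only obstruction to ζ ∈ G n is that ζ is too divisible
-- by 2; it then lies near the boundary of the octagon, and moving it by a suitable unit multiple of
-- the odd number β gives an odd point of the octagon.
--
-- Since G (n + 1) is the disjoint union of θ (G n) and of the odd points of an octagon, which are
-- four rotated copies of a quadrant, the cardinality follows by summing over the diagonals x + y = s.

module Submission where

open import Defs
open import Data.Nat using (ℕ; zero; suc; z≤n; s≤s; _∸_; _<_; _≥_) renaming (_+_ to _+ℕ_; _*_ to _*ℕ_; _≤_ to _≤ℕ_)
import Data.Nat.Properties as ℕ
open import Data.Integer using (ℤ; +_; -[1+_]; +[1+_]; -_; _+_; _-_; _*_; _^_; ∣_∣; _≤_; _≤?_; +≤+; -≤+; 0ℤ; 1ℤ; -1ℤ; drop‿+≤+)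
open import Data.Integer.DivMod using (_/ℕ_; _%ℕ_; a≡a%ℕn+[a/ℕn]*n; n%ℕd<d)
open import Data.Integer.Properties
open import Data.Integer.Tactic.RingSolver using (solve; solve-∀)
open import Algebra.Properties.AbelianGroup +-0-abelianGroup using () renaming (∙-cancelˡ to +-cancelˡ)
open import Data.List using (map; _++_; upTo; _∷_; [])
open import Data.List.Membership.Propositional using (_∈_)
open import Data.List.Membership.Propositional.Properties using (∈-map⁺; ∈-map⁻; ∈-++⁺ˡ; ∈-++⁺ʳ; ∈-++⁻; ∈-upTo⁺; ∈-upTo⁻)
open import Data.List.Properties using (length-map; length-++; length-upTo)
import Data.List.Relation.Unary.All as All
import Data.List.Relation.Unary.AllPairs as AllPairs
open import Data.List.Relation.Unary.Any using (here; there)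
open import Data.List.Relation.Unary.Unique.Propositional.Properties using (map⁺; ++⁺; upTo⁺)
open import Data.Product using (_×_; _,_; proj₁; proj₂; ∃-syntax)
open import Data.Sum using (_⊎_; inj₁; inj₂; [_,_]′)
open import Function.Bundles using (mk⇔; Equivalence)
open import Relation.Nullary using (¬_; yes; no; contradiction)
open import Relation.Binary.PropositionalEquality using (_≡_; refl; sym; trans; cong; cong₂; subst; subst₂)

open Equivalence using (to; from)

-- Linear arithmetic by certificates: L ≤ R is a sum of hypotheses, and the ring solver checks that
-- R′ - L′ = k + (R - L).
linear : ∀ {L R L′ R′} → L ≤ R → (k : ℕ) → R′ + L ≡ + k + (R + L′) → L′ ≤ R′
linear {L} {R} {L′} {R′} L≤R k eq = 0≤i-j⇒j≤i (subst (0ℤ ≤_) (sym slack)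
  (+-mono-≤ (+≤+ {0} {k} z≤n) (i≤j⇒0≤j-i L≤R)))
  where
  rearrange : ∀ L R L′ R′ → R′ - L′ ≡ (R′ + L) - (L + L′)
  rearrange = solve-∀
  cancel : ∀ k L R L′ → (k + (R + L′)) - (L + L′) ≡ k + (R - L)
  cancel = solve-∀
  slack : R′ - L′ ≡ + k + (R - L)
  slack = trans (rearrange L R L′ R′) (trans (cong (_- (L + L′)) eq) (cancel (+ k) L R L′))

infixr 5 _⊕_
_⊕_ : ∀ {a b c e : ℤ} → a ≤ b → c ≤ e → a + c ≤ b + e
_⊕_ = +-mono-≤

1≰0 : ¬ (1ℤ ≤ 0ℤ)
1≰0 (+≤+ ())

≤⊎> : ∀ a b → a ≤ b ⊎ 1ℤ + b ≤ a
≤⊎> a b with a ≤? b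
... | yes a≤b = inj₁ a≤b
... | no a≰b = inj₂ (i<j⇒suc[i]≤j (≰⇒> a≰b))

≤-by-contradiction : ∀ {a b} → ¬ (1ℤ + b ≤ a) → a ≤ b
≤-by-contradiction {a} {b} h with ≤⊎> a b
... | inj₁ a≤b = a≤b
... | inj₂ b<a = contradiction b<a h

double-cancel-≤ : ∀ {a b} → a + a ≤ b + b → a ≤ b
double-cancel-≤ {a} {b} p = ≤-by-contradiction λ b<a →
  1≰0 (linear (p ⊕ b<a ⊕ b<a) 1 (solve (a ∷ b ∷ [])))

0≤* : ∀ {a b} → 0ℤ ≤ a → 0ℤ ≤ b → 0ℤ ≤ a * b
0≤* {+ m} {+ n} _ _ = subst (0ℤ ≤_) (pos-* m n) (+≤+ z≤n)

m+m≢1+n+n : ∀ m n → ¬ (m + m ≡ 1ℤ + (n + n))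
m+m≢1+n+n m n eq with ≤⊎> m n
... | inj₁ m≤n = 1≰0 (linear (m≤n ⊕ m≤n ⊕ ≤-reflexive (sym eq)) 0 (solve (m ∷ n ∷ [])))
... | inj₂ n<m = 1≰0 (linear (n<m ⊕ n<m ⊕ ≤-reflexive eq) 0 (solve (m ∷ n ∷ [])))

parity : ∀ a → (∃[ k ] a ≡ k + k) ⊎ (∃[ k ] a ≡ 1ℤ + (k + k))
parity (+ n) = nat n
  where
  nat : ∀ n → (∃[ k ] + n ≡ k + k) ⊎ (∃[ k ] + n ≡ 1ℤ + (k + k))
  nat zero = inj₁ (0ℤ , refl)
  nat (suc n) with nat n
  ... | inj₁ (k , eq) = inj₂ (k , cong (λ t → 1ℤ + t) eq)
  ... | inj₂ (k , eq) = inj₁ (1ℤ + k , trans (cong (λ t → 1ℤ + t) eq) (solve (k ∷ [])))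
parity -[1+ n ] with parity (+[1+ n ])
... | inj₁ (k , eq) = inj₁ (- k , trans (cong (-_) eq) (solve (k ∷ [])))
... | inj₂ (k , eq) = inj₂ (- 1ℤ - k , trans (cong (-_) eq) (solve (k ∷ [])))

-- Gaussian integers

0ᵍ 1ᵍ : ℤ[i]
0ᵍ = 0ℤ + 0ℤ i
1ᵍ = 1ℤ + 0ℤ i

_+ᵍ_ : ℤ[i] → ℤ[i] → ℤ[i]
(a + b i) +ᵍ (c + e i) = (a + c) + (b + e) i

rot : ℤ[i] → ℤ[i]
rot (x + y i) = (- y) + x i

conj : ℤ[i] → ℤ[i]
conj (x + y i) = x + (- y) i

θ : ℤ[i] → ℤ[i]
θ (x + y i) = (x - y) + (x + y) i

rot^ : ℕ → ℤ[i] → ℤ[i]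
rot^ zero z = z
rot^ (suc k) z = rot^ k (rot z)

rot⁴ : ∀ z → rot^ 4 z ≡ z
rot⁴ (x + y i) = cong₂ _+_i (neg-involutive x) (neg-involutive y)

rot-θ : ∀ z → rot (θ z) ≡ θ (rot z)
rot-θ (x + y i) = cong₂ _+_i (re-eq x y) (im-eq x y)
  where
  re-eq : ∀ x y → - (x + y) ≡ - y - x
  re-eq = solve-∀
  im-eq : ∀ x y → x - y ≡ - y + x
  im-eq = solve-∀

conj-θ : ∀ z → conj (θ z) ≡ θ (conj (rot z))
conj-θ (x + y i) = cong₂ _+_i (re-eq x y) (im-eq x y)
  where
  re-eq : ∀ x y → x - y ≡ - y - - x
  re-eq = solve-∀
  im-eq : ∀ x y → - (x + y) ≡ - y + - x
  im-eq = solve-∀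

conj-conj : ∀ z → conj (conj z) ≡ z
conj-conj (x + y i) = cong (x +_i) (neg-involutive y)

-- The sum and the difference of the coordinates of `θ z` are `2 x` and `2 y`, and doubling is
-- injective.
θ-injective : ∀ {z z′} → θ z ≡ θ z′ → z ≡ z′
θ-injective {x + y i} {x′ + y′ i} eq = cong₂ _+_i x≡x′ y≡y′
  where
  re-eq : x - y ≡ x′ - y′
  re-eq = cong re eq
  im-eq : x + y ≡ x′ + y′
  im-eq = cong im eq
  double : ∀ x y → (x + x) ≡ (x - y) + (x + y)
  double = solve-∀
  double′ : ∀ x y → (y + y) ≡ (x + y) - (x - y)
  double′ = solve-∀
  half : ∀ {a b : ℤ} → a + a ≡ b + b → a ≡ b
  half eq = ≤-antisym (double-cancel-≤ (≤-reflexive eq)) (double-cancel-≤ (≤-reflexive (sym eq)))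
  x≡x′ : x ≡ x′
  x≡x′ = half (trans (double x y) (trans (cong₂ _+_ re-eq im-eq) (sym (double x′ y′))))
  y≡y′ : y ≡ y′
  y≡y′ = half (trans (double′ x y) (trans (cong₂ _-_ im-eq re-eq) (sym (double′ x′ y′))))

-- Modulo `1 + i` both `1` and `i` lie in the nonzero class, so `1 + i` divides `x + y i` exactly
-- when `x + y` is even.
Odd : ℤ[i] → Set
Odd z = ∃[ k ] re z + im z ≡ 1ℤ + (k + k)

odd⊎even : ∀ z → Odd z ⊎ (∃[ η ] z ≡ θ η)
odd⊎even (x + y i) with parity (x + y)
... | inj₂ odd = inj₁ odd
-- With `x + y = 2 k` the quotient by `1 + i` is `((x + y) + (y - x) i) / 2 = k + (k - x) i`.
... | inj₁ (k , eq) = inj₂ (k + (k - x) i , cong₂ _+_i (re-eq k x) (trans (move x y) (trans (cong (_- x) eq) (im-eq k x))))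
  where
  re-eq : ∀ k x → x ≡ k - (k - x)
  re-eq = solve-∀
  im-eq : ∀ k x → k + k - x ≡ k + (k - x)
  im-eq = solve-∀
  move : ∀ x y → y ≡ (x + y) - x
  move = solve-∀

odd-θ : ∀ z → ¬ Odd (θ z)
odd-θ (x + y i) (k , eq) = m+m≢1+n+n x k (trans (move x y) eq)
  where
  move : ∀ x y → x + x ≡ (x - y) + (x + y)
  move = solve-∀

odd-rot : ∀ z → Odd z → Odd (rot z)
odd-rot (x + y i) (k , eq) = k - y , trans (move x y) (trans (cong (_- (y + y)) eq) (solve (k ∷ y ∷ [])))
  where
  move : ∀ x y → - y + x ≡ (x + y) - (y + y)
  move = solve-∀

odd-conj : ∀ z → Odd z → Odd (conj z)
odd-conj (x + y i) (k , eq) = k - y , trans (move x y) (trans (cong (_- (y + y)) eq) (solve (k ∷ y ∷ [])))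
  where
  move : ∀ x y → x + - y ≡ (x + y) - (y + y)
  move = solve-∀

odd-θ+ : ∀ z z′ → Odd z′ → Odd (θ z +ᵍ z′)
odd-θ+ (x + y i) (x′ + y′ i) (k , eq) = x + k ,
  trans (move x y x′ y′) (trans (cong (λ t → x + x + t) eq) (solve (x ∷ k ∷ [])))
  where
  move : ∀ x y x′ y′ → (x - y + x′) + (x + y + y′) ≡ x + x + (x′ + y′)
  move = solve-∀

-- Octagons

Half : ℤ → ℤ → ℤ[i] → Set
Half M S z = re z ≤ M × re z + im z ≤ S

-- The octagon |x|, |y| ≤ M, |x| + |y| ≤ S, as an intersection of rotated half-planes.
record Oct (M S : ℤ) (z : ℤ[i]) : Set where
  constructor oct
  field half : ∀ k → Half M S (rot^ k z)
open Oct

-- Symmetry arguments go through this: for a property stable under quarter turns, two sides of the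
-- octagon stand for all eight.
oct-coind : ∀ {M S} (P : ℤ[i] → Set) → (∀ z → P z → Half M S z) → (∀ z → P z → P (rot z)) →
            ∀ {z} → P z → Oct M S z
oct-coind {M} {S} P P⇒half P-rot Pz = oct λ k → go k _ Pz
  where
  go : ∀ k z → P z → Half M S (rot^ k z)
  go zero z p = P⇒half z p
  go (suc k) z p = go k (rot z) (P-rot z p)

oct-mono : ∀ {M S M′ S′ z} → M ≤ M′ → S ≤ S′ → Oct M S z → Oct M′ S′ z
oct-mono p q o = oct λ k → ≤-trans (proj₁ (half o k)) p , ≤-trans (proj₂ (half o k)) q

oct-rot : ∀ {M S z} → Oct M S z → Oct M S (rot z)
oct-rot o = oct λ k → half o (suc k)

oct-unrot : ∀ {M S z} → Oct M S (rot z) → Oct M S z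
oct-unrot {z = z} o = subst (Oct _ _) (rot⁴ z) (oct-rot (oct-rot (oct-rot o)))

oct-conj : ∀ {M S z} → Oct M S z → Oct M S (conj z)
oct-conj {M} {S} {z} o = oct-coind (λ z → Oct M S (conj z)) bound rotate
    (subst (Oct M S) (sym (conj-conj z)) o)
  where
  bound : ∀ z → Oct M S (conj z) → Half M S z
  bound (x + y i) o = proj₁ (half o 0) , subst (_≤ S) (swap x y) (proj₂ (half o 1))
    where
    swap : ∀ x y → - - y + x ≡ x + y
    swap = solve-∀
  rotate : ∀ z → Oct M S (conj z) → Oct M S (conj (rot z))
  rotate (x + y i) o = subst (λ t → Oct M S (t + (- x) i)) (neg-involutive (- y))
    (oct-rot (oct-rot (oct-rot o)))

oct-+ : ∀ {M S M′ S′ z z′} → Oct M S z → Oct M′ S′ z′ → Oct (M + M′) (S + S′) (z +ᵍ z′)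
oct-+ {M} {S} {M′} {S′} o o′ = oct-coind Sum bound rotate (_ , _ , refl , o , o′)
  where
  Sum : ℤ[i] → Set
  Sum s = ∃[ z ] ∃[ z′ ] (s ≡ z +ᵍ z′ × Oct M S z × Oct M′ S′ z′)
  bound : ∀ s → Sum s → Half (M + M′) (S + S′) s
  bound _ (x + y i , x′ + y′ i , refl , o , o′) =
    (proj₁ (half o 0) ⊕ proj₁ (half o′ 0)) ,
    subst (_≤ S + S′) (interchange x y x′ y′) (proj₂ (half o 0) ⊕ proj₂ (half o′ 0))
    where
    interchange : ∀ x y x′ y′ → (x + y) + (x′ + y′) ≡ (x + x′) + (y + y′)
    interchange = solve-∀
  rotate : ∀ s → Sum s → Sum (rot s)
  rotate _ (x + y i , x′ + y′ i , refl , o , o′) =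
    _ , _ , cong (_+ (x + x′) i) (neg-distrib-+ y y′) , oct-rot o , oct-rot o′

-- `θ` turns by 45 degrees and stretches by √2, so the two kinds of sides trade places.
oct-θ : ∀ {M S z} → Oct M S z → Oct S (M + M) (θ z)
oct-θ {M} {S} o = oct-coind (λ t → ∃[ z ] (t ≡ θ z × Oct M S z)) bound
    (λ { _ (z , refl , o) → rot z , rot-θ z , oct-rot o }) (_ , refl , o)
  where
  bound : ∀ t → (∃[ z ] (t ≡ θ z × Oct M S z)) → Half S (M + M) t
  bound _ (x + y i , refl , o) =
    subst (_≤ S) (re-eq x y) (proj₂ (half o 1)) ,
    subst (_≤ M + M) (im-eq x y) (proj₁ (half o 0) ⊕ proj₁ (half o 0))
    where
    re-eq : ∀ x y → - y + x ≡ x - y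
    re-eq = solve-∀
    im-eq : ∀ x y → x + x ≡ (x - y) + (x + y)
    im-eq = solve-∀

record Oct₈ (M S : ℤ) (z : ℤ[i]) : Set where
  constructor oct₈
  field
    x≤ : re z ≤ M
    -x≤ : - re z ≤ M
    y≤ : im z ≤ M
    -y≤ : - im z ≤ M
    x+y≤ : re z + im z ≤ S
    y-x≤ : - re z + im z ≤ S
    x-y≤ : re z - im z ≤ S
    -x-y≤ : - re z - im z ≤ S

oct₈⇒oct : ∀ {M S z} → Oct₈ M S z → Oct M S z
oct₈⇒oct {M} {S} = oct-coind (Oct₈ M S) (λ _ o → Oct₈.x≤ o , Oct₈.x+y≤ o) rotate
  where
  rotate : ∀ z → Oct₈ M S z → Oct₈ M S (rot z)
  rotate (x + y i) (oct₈ a b c e f g h j) = oct₈ e (subst (_≤ M) (sym (neg-involutive y)) c) a b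
    (subst (_≤ S) (+-comm x (- y)) h) (subst (_≤ S) (swap x y) f)
    (subst (_≤ S) (+-comm (- x) (- y)) j) (subst (_≤ S) (swap′ x y) g)
    where
    swap : ∀ x y → x + y ≡ - - y + x
    swap = solve-∀
    swap′ : ∀ x y → - x + y ≡ - - y - x
    swap′ = solve-∀

oct⇒oct₈ : ∀ {M S z} → Oct M S z → Oct₈ M S z
oct⇒oct₈ {M} {S} {x + y i} o = oct₈
  (proj₁ (half o 0)) (proj₁ (half o 2))
  (subst (_≤ M) (neg-involutive y) (proj₁ (half o 3))) (proj₁ (half o 1))
  (proj₂ (half o 0)) (subst (_≤ S) (swap x y) (proj₂ (half o 3)))
  (subst (_≤ S) (+-comm (- y) x) (proj₂ (half o 1))) (proj₂ (half o 2))
  where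
  swap : ∀ x y → - - y - x ≡ - x + y
  swap = solve-∀

-- Octagon sizes and the sets `G n`.

w d : ℕ → ℤ
w 0 = + 3
w 1 = + 4
w (suc (suc n)) = w n + w n
d 0 = + 1
d 1 = + 2
d (suc (suc n)) = d n + d n

-- Both sequences double every two levels, as θ² = 2i does, so two initial values decide. `d n` is
-- the largest absolute coordinate of `(1 + i)ⁿ⁺¹`.
w-suc : ∀ n → w (suc n) ≡ w n + d n
w-suc 0 = refl
w-suc 1 = refl
w-suc (suc (suc n)) = trans (cong₂ _+_ (w-suc n) (w-suc n)) (interchange (w n) (d n))
  where
  interchange : ∀ a b → (a + b) + (a + b) ≡ (a + a) + (b + b)
  interchange = solve-∀

1≤d : ∀ n → 1ℤ ≤ d n
1≤d 0 = +≤+ (s≤s z≤n)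
1≤d 1 = +≤+ (s≤s z≤n)
1≤d (suc (suc n)) = ≤-trans (+≤+ (s≤s z≤n)) (1≤d n ⊕ 1≤d n)

2d≤w : ∀ n → d n + d n ≤ w n
2d≤w 0 = +≤+ (s≤s (s≤s z≤n))
2d≤w 1 = ≤-refl
2d≤w (suc (suc n)) = 2d≤w n ⊕ 2d≤w n

w≤3d : ∀ n → w n ≤ d n + d n + d n
w≤3d 0 = ≤-refl
w≤3d 1 = +≤+ (s≤s (s≤s (s≤s (s≤s z≤n))))
w≤3d (suc (suc n)) = linear (w≤3d n ⊕ w≤3d n) 0 (double (w n) (d n))
  where
  double : ∀ w d → (d + d) + (d + d) + (d + d) + (w + w) ≡ 0ℤ + ((d + d + d) + (d + d + d) + (w + w))
  double = solve-∀

w-even : ∀ n → ∃[ h ] w (suc n) ≡ h + h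
w-even 0 = + 2 , refl
w-even (suc n) = w n , refl

Octₙ : ℕ → ℤ[i] → Set
Octₙ n = Oct (w n - + 2) (w (suc n) - + 3)

w-mono : ∀ n → w n ≤ w (suc n)
w-mono n = ≤-trans (linear (1≤d n) 1 (cancel (w n) (d n))) (≤-reflexive (sym (w-suc n)))
  where
  cancel : ∀ w d → w + d + 1ℤ ≡ 1ℤ + (d + w)
  cancel = solve-∀

octₙ-suc : ∀ n {z} → Octₙ n z → Octₙ (suc n) z
octₙ-suc n = oct-mono (+-monoˡ-≤ _ (w-mono n)) (+-monoˡ-≤ _ (w-mono (suc n)))

-- Factors `1 + i` are peeled off one per level. Level 0 fits the pattern: its octagon is the
-- diamond of radius 1, whose lattice points are 0 and the four units.
data G : ℕ → ℤ[i] → Set where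
  small : ∀ {z} → A₀ z → G 0 z
  odd : ∀ {n z} → Odd z → Octₙ (suc n) z → G (suc n) z
  even : ∀ {n z} η → z ≡ θ η → G n η → G (suc n) z

pattern is0 p = inj₁ p
pattern is1 p = inj₂ (inj₁ p)
pattern is-1 p = inj₂ (inj₂ (inj₁ p))
pattern is-i p = inj₂ (inj₂ (inj₂ (inj₁ p)))
pattern is--i p = inj₂ (inj₂ (inj₂ (inj₂ p)))

A₀-rot : ∀ {z} → A₀ z → A₀ (rot z)
A₀-rot (is0 refl) = is0 refl
A₀-rot (is1 refl) = is-i refl
A₀-rot (is-1 refl) = is--i refl
A₀-rot (is-i refl) = is-1 refl
A₀-rot (is--i refl) = is1 refl

A₀-conj : ∀ {z} → A₀ z → A₀ (conj z)
A₀-conj (is0 refl) = is0 refl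
A₀-conj (is1 refl) = is1 refl
A₀-conj (is-1 refl) = is-1 refl
A₀-conj (is-i refl) = is--i refl
A₀-conj (is--i refl) = is-i refl

A₀⇒oct : ∀ {z} → A₀ z → Oct 1ℤ 1ℤ z
A₀⇒oct = oct-coind A₀ bound (λ _ → A₀-rot)
  where
  bound : ∀ z → A₀ z → Half 1ℤ 1ℤ z
  bound _ (is0 refl) = +≤+ z≤n , +≤+ z≤n
  bound _ (is1 refl) = ≤-refl , ≤-refl
  bound _ (is-1 refl) = -≤+ , -≤+
  bound _ (is-i refl) = +≤+ z≤n , ≤-refl
  bound _ (is--i refl) = +≤+ z≤n , -≤+

A₀⇒0⊎odd : ∀ {z} → A₀ z → z ≡ 0ᵍ ⊎ Odd z
A₀⇒0⊎odd (is0 p) = inj₁ p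
A₀⇒0⊎odd (is1 refl) = inj₂ (0ℤ , refl)
A₀⇒0⊎odd (is-1 refl) = inj₂ (- 1ℤ , refl)
A₀⇒0⊎odd (is-i refl) = inj₂ (0ℤ , refl)
A₀⇒0⊎odd (is--i refl) = inj₂ (- 1ℤ , refl)

data Trit : ℤ → Set where
  t-1 : Trit (- 1ℤ)
  t0 : Trit 0ℤ
  t1 : Trit 1ℤ

4≤sq : ∀ {c} → + 2 ≤ c → + 4 ≤ c * c
4≤sq {c} 2≤c = linear (0≤* (i≤j⇒0≤j-i 2≤c) (i≤j⇒0≤j-i 2≤c) ⊕ 2≤c ⊕ 2≤c ⊕ 2≤c ⊕ 2≤c) 0 (solve (c ∷ []))

trit⊎4≤sq : ∀ c → Trit c ⊎ + 4 ≤ c * c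
trit⊎4≤sq (+ 0) = inj₁ t0
trit⊎4≤sq (+ 1) = inj₁ t1
trit⊎4≤sq (+ suc (suc n)) = inj₂ (4≤sq (+≤+ (s≤s (s≤s z≤n))))
trit⊎4≤sq -[1+ 0 ] = inj₁ t-1
trit⊎4≤sq -[1+ suc n ] = inj₂ (4≤sq (+≤+ (s≤s (s≤s z≤n))))

0≤sq : ∀ x → 0ℤ ≤ x * x
0≤sq x with trit⊎4≤sq x
... | inj₁ t-1 = +≤+ z≤n
... | inj₁ t0 = +≤+ z≤n
... | inj₁ t1 = +≤+ z≤n
... | inj₂ p = ≤-trans (+≤+ z≤n) p

sq-mono : ∀ {a b} → 0ℤ ≤ a → a ≤ b → a * a ≤ b * b
sq-mono {a} {b} 0≤a a≤b = linear
  (0≤* 0≤a (i≤j⇒0≤j-i a≤b) ⊕ 0≤* 0≤a (i≤j⇒0≤j-i a≤b) ⊕ 0≤sq (b - a)) 0 (solve (a ∷ b ∷ []))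

¬odd-0 : ¬ Odd 0ᵍ
¬odd-0 = odd-θ 0ᵍ

-- A point with both coordinates in `-1, 0, 1` is 0, a unit or `±1 ± i`, and the last four are
-- multiples of `1 + i`. Any other point has a coordinate whose square is at least 4.
odd⇒A₀⊎4≤norm : ∀ {z} → Odd z → A₀ z ⊎ + 4 ≤ re z * re z + im z * im z
odd⇒A₀⊎4≤norm {c + e i} o with trit⊎4≤sq c | trit⊎4≤sq e
... | inj₂ 4≤c² | _ = inj₂ (4≤c² ⊕ 0≤sq e)
... | inj₁ t-1 | inj₂ 4≤e² = inj₂ (≤-trans 4≤e² (i≤j+i _ 1ℤ))
... | inj₁ t0 | inj₂ 4≤e² = inj₂ (≤-trans 4≤e² (i≤j+i _ 0ℤ))
... | inj₁ t1 | inj₂ 4≤e² = inj₂ (≤-trans 4≤e² (i≤j+i _ 1ℤ))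
... | inj₁ t-1 | inj₁ t0 = inj₁ (is-1 refl)
... | inj₁ t1 | inj₁ t0 = inj₁ (is1 refl)
... | inj₁ t0 | inj₁ t-1 = inj₁ (is--i refl)
... | inj₁ t0 | inj₁ t1 = inj₁ (is-i refl)
... | inj₁ t0 | inj₁ t0 = inj₁ (is0 refl)
... | inj₁ t-1 | inj₁ t-1 = contradiction o (odd-θ (-1ℤ + 0ℤ i))
... | inj₁ t-1 | inj₁ t1 = contradiction o (odd-θ (0ℤ + 1ℤ i))
... | inj₁ t1 | inj₁ t-1 = contradiction o (odd-θ (0ℤ + -1ℤ i))
... | inj₁ t1 | inj₁ t1 = contradiction o (odd-θ 1ᵍ)

oct11⇒A₀ : ∀ {z} → Oct 1ℤ 1ℤ z → A₀ z
oct11⇒A₀ {x + y i} o = go x y (oct⇒oct₈ o)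
  where
  trit : ∀ x → x ≤ 1ℤ → - x ≤ 1ℤ → Trit x
  trit (+ 0) _ _ = t0
  trit (+ 1) _ _ = t1
  trit (+ suc (suc n)) (+≤+ (s≤s ())) _
  trit -[1+ 0 ] _ _ = t-1
  trit -[1+ suc n ] _ (+≤+ (s≤s ()))
  go : ∀ x y → Oct₈ 1ℤ 1ℤ (x + y i) → A₀ (x + y i)
  go x y o@(oct₈ a b c e _ _ _ _) with trit x a b | trit y c e
  ... | t0 | t0 = is0 refl
  ... | t-1 | t0 = is-1 refl
  ... | t1 | t0 = is1 refl
  ... | t0 | t-1 = is--i refl
  ... | t0 | t1 = is-i refl
  ... | t1 | t1 with +≤+ (s≤s ()) ← Oct₈.x+y≤ o
  ... | t1 | t-1 with +≤+ (s≤s ()) ← Oct₈.x-y≤ o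
  ... | t-1 | t1 with +≤+ (s≤s ()) ← Oct₈.y-x≤ o
  ... | t-1 | t-1 with +≤+ (s≤s ()) ← Oct₈.-x-y≤ o

odd-oct⇒G : ∀ n {z} → Odd z → Octₙ n z → G n z
odd-oct⇒G zero _ oz = small (oct11⇒A₀ oz)
odd-oct⇒G (suc n) z-odd oz = odd z-odd oz

-- `θ` carries the octagon of one level into that of the next with one unit to spare on each side.
G⇒oct : ∀ n {z} → G n z → Octₙ n z
G⇒oct zero (small a) = A₀⇒oct a
G⇒oct (suc n) (odd _ o) = o
G⇒oct (suc n) (even _ refl g) =
  oct-mono (lemma₁ (w (suc n))) (lemma₂ (w n)) (oct-θ (G⇒oct n g))
  where
  lemma₁ : ∀ a → a - + 3 ≤ a - + 2
  lemma₁ a = linear (≤-refl {0ℤ}) 1 (solve (a ∷ []))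
  lemma₂ : ∀ a → (a - + 2) + (a - + 2) ≤ (a + a) - + 3
  lemma₂ a = linear (≤-refl {0ℤ}) 1 (solve (a ∷ []))

G-rot : ∀ n {z} → G n z → G n (rot z)
G-rot zero (small a) = small (A₀-rot a)
G-rot (suc n) {z} (odd z-odd o) = odd (odd-rot z z-odd) (oct-rot o)
G-rot (suc n) (even η refl g) = even (rot η) (rot-θ η) (G-rot n g)

G-unrot : ∀ n {z} → G n (rot z) → G n z
G-unrot n {z} g = subst (G n) (rot⁴ z) (G-rot n (G-rot n (G-rot n g)))

G-conj : ∀ n {z} → G n z → G n (conj z)
G-conj zero (small a) = small (A₀-conj a)
G-conj (suc n) {z} (odd z-odd o) = odd (odd-conj z z-odd) (oct-conj o)
G-conj (suc n) (even η refl g) = even _ (conj-θ η) (G-conj n (G-rot n g))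

G-0 : ∀ n → G n 0ᵍ
G-0 zero = small (is0 refl)
G-0 (suc n) = even 0ᵍ refl (G-0 n)

G-suc : ∀ n {z} → G n z → G (suc n) z
G-suc zero (small a) with A₀⇒0⊎odd a
... | inj₁ refl = G-0 1
... | inj₂ z-odd = odd z-odd (octₙ-suc 0 (A₀⇒oct a))
G-suc (suc n) (odd z-odd o) = odd z-odd (octₙ-suc (suc n) o)
G-suc (suc n) (even η refl g) = even η refl (G-suc n g)

G-θ⁻¹ : ∀ n {z} → G (suc n) (θ z) → G n z
G-θ⁻¹ n {z} (odd θz-odd _) = contradiction θz-odd (odd-θ z)
G-θ⁻¹ n (even η eq g) = subst (G n) (sym (θ-injective eq)) g

G₀-θ : ∀ {z} → G 0 (θ z) → z ≡ 0ᵍ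
G₀-θ {z} (small a) with A₀⇒0⊎odd a
... | inj₁ eq = θ-injective eq
... | inj₂ θz-odd = contradiction θz-odd (odd-θ z)

-- Divisors

norm : ℤ[i] → ℤ
norm (x + y i) = x * x + y * y

norm-rot : ∀ z → norm (rot z) ≡ norm z
norm-rot (x + y i) = lemma x y
  where
  lemma : ∀ x y → - y * - y + x * x ≡ x * x + y * y
  lemma = solve-∀

norm-* : ∀ z z′ → norm (z *ᵍ z′) ≡ norm z * norm z′
norm-* (a + b i) (c + e i) = lemma a b c e
  where
  lemma : ∀ a b c e → (a * c - b * e) * (a * c - b * e) + (a * e + b * c) * (a * e + b * c)
                    ≡ (a * a + b * b) * (c * c + e * e)
  lemma = solve-∀

0≤norm : ∀ z → 0ℤ ≤ norm z
0≤norm (x + y i) = 0≤sq x ⊕ 0≤sq y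

-- The doubled form comes from adding `(S - x - y) (S + x + y) ≥ 0` and
-- `(S - x + y) (S + x - y) ≥ 0`, which avoids a case distinction on signs.
norm≤S² : ∀ {M S z} → Oct M S z → norm z + norm z ≤ S * S + S * S
norm≤S² {M} {S} {x + y i} o = lemma x y S (Oct₈.x+y≤ o₈) (Oct₈.-x-y≤ o₈) (Oct₈.x-y≤ o₈) (Oct₈.y-x≤ o₈)
  where
  o₈ = oct⇒oct₈ o
  lemma : ∀ x y S → x + y ≤ S → - x - y ≤ S → x - y ≤ S → - x + y ≤ S →
          (x * x + y * y) + (x * x + y * y) ≤ S * S + S * S
  lemma x y S a b c e = linear
    (0≤* (i≤j⇒0≤j-i a) (i≤j⇒0≤j-i b) ⊕ 0≤* (i≤j⇒0≤j-i c) (i≤j⇒0≤j-i e)) 0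
    (solve (x ∷ y ∷ S ∷ []))

-- The disc of radius `S / 2` fits: `|x| ≤ S / 2 ≤ M + 1/2` forces `|x| ≤ M` for integers, and
-- `|x| + |y| ≤ √2 |z| ≤ S`.
4norm≤S²⇒oct : ∀ {M S z} → 1ℤ ≤ S → S ≤ M + M + 1ℤ →
  + 4 * norm z ≤ S * S → Oct M S z
4norm≤S²⇒oct {M} {S} 1≤S S≤2M+1 = oct-coind (λ z → + 4 * norm z ≤ S * S)
  (λ { (x + y i) p → re-bound x y p , sum-bound x y p })
  (λ z p → subst (λ t → + 4 * t ≤ S * S) (sym (norm-rot z)) p)
  where
  0≤1+S : 0ℤ ≤ 1ℤ + S
  0≤1+S = ≤-trans (+≤+ z≤n) (+-monoʳ-≤ 1ℤ 1≤S)
  re-bound : ∀ x y → + 4 * (x * x + y * y) ≤ S * S → x ≤ M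
  re-bound x y p = ≤-by-contradiction λ M<x → 1≰0 (contra (2x>S M<x))
    where
    2x>S : 1ℤ + M ≤ x → 1ℤ + S ≤ x + x
    2x>S M<x = linear (M<x ⊕ M<x ⊕ S≤2M+1) 0 (solve (x ∷ M ∷ S ∷ []))
    contra : 1ℤ + S ≤ x + x → 1ℤ ≤ 0ℤ
    contra q = linear (p ⊕ sq-mono 0≤1+S q ⊕ 0≤sq (y + y) ⊕ 1≤S ⊕ 1≤S) 2
      (solve (x ∷ y ∷ S ∷ []))
  sum-bound : ∀ x y → + 4 * (x * x + y * y) ≤ S * S → x + y ≤ S
  sum-bound x y p = ≤-by-contradiction λ S<x+y → 1≰0 (linear
    (p ⊕ sq-mono 0≤1+S S<x+y ⊕ sq-mono 0≤1+S S<x+y ⊕ 0≤sq (x - y) ⊕ 0≤sq (x - y) ⊕ 0≤sq S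
      ⊕ 1≤S ⊕ 1≤S ⊕ 1≤S ⊕ 1≤S) 5 (solve (x ∷ y ∷ S ∷ [])))

*ᵍ-θˡ : ∀ z z′ → θ z *ᵍ z′ ≡ θ (z *ᵍ z′)
*ᵍ-θˡ (a + b i) (c + e i) = cong₂ _+_i (re-eq a b c e) (im-eq a b c e)
  where
  re-eq : ∀ a b c e → (a - b) * c - (a + b) * e ≡ (a * c - b * e) - (a * e + b * c)
  re-eq = solve-∀
  im-eq : ∀ a b c e → (a - b) * e + (a + b) * c ≡ (a * c - b * e) + (a * e + b * c)
  im-eq = solve-∀

*ᵍ-comm : ∀ z z′ → z *ᵍ z′ ≡ z′ *ᵍ z
*ᵍ-comm (a + b i) (c + e i) = cong₂ _+_i (re-eq a b c e) (im-eq a b c e)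
  where
  re-eq : ∀ a b c e → a * c - b * e ≡ c * a - e * b
  re-eq = solve-∀
  im-eq : ∀ a b c e → a * e + b * c ≡ c * b + e * a
  im-eq = solve-∀

*ᵍ-θʳ : ∀ z z′ → z *ᵍ θ z′ ≡ θ (z *ᵍ z′)
*ᵍ-θʳ z z′ = trans (*ᵍ-comm z (θ z′)) (trans (*ᵍ-θˡ z′ z) (cong θ (*ᵍ-comm z′ z)))

*ᵍ-1 : ∀ z → z *ᵍ 1ᵍ ≡ z
*ᵍ-1 (a + b i) = cong₂ _+_i (re-eq a b) (im-eq a b)
  where
  re-eq : ∀ a b → a * 1ℤ - b * 0ℤ ≡ a
  re-eq = solve-∀
  im-eq : ∀ a b → a * 0ℤ + b * 1ℤ ≡ b
  im-eq = solve-∀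

*ᵍ-rot : ∀ z z′ → z *ᵍ rot z′ ≡ rot (z *ᵍ z′)
*ᵍ-rot (a + b i) (c + e i) = cong₂ _+_i (re-eq a b c e) (im-eq a b c e)
  where
  re-eq : ∀ a b c e → a * - e - b * c ≡ - (a * e + b * c)
  re-eq = solve-∀
  im-eq : ∀ a b c e → a * c + b * - e ≡ a * c - b * e
  im-eq = solve-∀

oct-*-unit : ∀ {M S} z {u} → A₀ u → ¬ u ≡ 0ᵍ → Oct M S (z *ᵍ u) → Oct M S z
oct-*-unit {M} {S} z {u} a u≢0 = go a u≢0
  where
  unrot : ∀ {u} → (Oct M S (z *ᵍ u) → Oct M S z) → Oct M S (z *ᵍ rot u) → Oct M S z
  unrot {u} f o = f (oct-unrot (subst (Oct M S) (*ᵍ-rot z u) o))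
  times-1 : Oct M S (z *ᵍ 1ᵍ) → Oct M S z
  times-1 = subst (Oct M S) (*ᵍ-1 z)
  go : ∀ {u} → A₀ u → ¬ u ≡ 0ᵍ → Oct M S (z *ᵍ u) → Oct M S z
  go (is0 eq) u≢0 = contradiction eq u≢0
  go (is1 refl) _ = times-1
  go (is-i refl) _ = unrot times-1
  go (is-1 refl) _ = unrot (unrot times-1)
  go (is--i refl) _ = unrot (unrot (unrot times-1))

odd⇒≢0 : ∀ {z} → Odd z → ¬ z ≡ 0ᵍ
odd⇒≢0 z-odd refl = ¬odd-0 z-odd

-- An odd cofactor that is not a unit has norm at least 4, so `4 |β|² ≤ |β γ|² ≤ S²` puts `β` in the
-- disc of radius `S / 2`. A unit cofactor only rotates.
octₙ-divisor : ∀ n β γ → Odd γ → Octₙ n (β *ᵍ γ) → Octₙ n β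
octₙ-divisor n β γ@(c + e i) γ-odd o with odd⇒A₀⊎4≤norm γ-odd
... | inj₁ unit = oct-*-unit β unit (odd⇒≢0 γ-odd) o
... | inj₂ 4≤norm = 4norm≤S²⇒oct (1≤S n) S≤2M+1 (≤-trans lower (double-cancel-≤ (norm≤S² {z = β *ᵍ γ} o)))
  where
  1≤S : ∀ n → 1ℤ ≤ w (suc n) - + 3
  1≤S zero = +≤+ (s≤s z≤n)
  1≤S (suc n) = ≤-trans (1≤S n) (+-monoˡ-≤ (- + 3) (w-mono (suc n)))
  bound : ∀ w d → 1ℤ ≤ d → d + d ≤ w → w + d - + 3 ≤ (w - + 2) + (w - + 2) + 1ℤ
  bound w d 1≤d 2d≤w = linear (1≤d ⊕ 2d≤w) 1 (solve (w ∷ d ∷ []))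
  S≤2M+1 : w (suc n) - + 3 ≤ (w n - + 2) + (w n - + 2) + 1ℤ
  S≤2M+1 = subst (λ t → t - + 3 ≤ (w n - + 2) + (w n - + 2) + 1ℤ) (sym (w-suc n))
    (bound (w n) (d n) (1≤d n) (2d≤w n))
  scale : ∀ a b → 0ℤ ≤ a → + 4 ≤ b → + 4 * a ≤ a * b
  scale a b p q = linear (0≤* p (i≤j⇒0≤j-i q)) 0 (solve (a ∷ b ∷ []))
  lower : + 4 * norm β ≤ norm (β *ᵍ γ)
  lower = subst (+ 4 * norm β ≤_) (sym (norm-* β γ)) (scale _ _ (0≤norm β) 4≤norm)

G-divisor : ∀ n β γ {δ} → δ ≡ β *ᵍ γ → ¬ (δ ≡ 0ᵍ) → G n δ → G n β
-- A factor `1 + i` of the product lowers the level. It may come from either factor, hence the two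
-- conclusions: `θ β` if from the first, `β` if from the second. Level 0 has no nonzero multiple of
-- `1 + i`.
G-divisor-θ : ∀ n β γ {δ} → δ ≡ θ (β *ᵍ γ) → ¬ (δ ≡ 0ᵍ) → G n δ →
  G n (θ β) × G n β
G-divisor n β γ {δ} δ≡βγ δ≢0 g = by-parity (odd⊎even β) (odd⊎even γ)
  where
  by-parity : Odd β ⊎ (∃[ η ] β ≡ θ η) → Odd γ ⊎ (∃[ η ] γ ≡ θ η) → G n β
  by-parity (inj₁ β-odd) (inj₁ γ-odd) =
    odd-oct⇒G n β-odd (octₙ-divisor n β γ γ-odd (subst (Octₙ n) δ≡βγ (G⇒oct n g)))
  by-parity (inj₂ (η , β≡θη)) _ = subst (G n) (sym β≡θη) (proj₁
    (G-divisor-θ n η γ (trans δ≡βγ (trans (cong (_*ᵍ γ) β≡θη) (*ᵍ-θˡ η γ))) δ≢0 g))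
  by-parity (inj₁ _) (inj₂ (η , γ≡θη)) = proj₂
    (G-divisor-θ n β η (trans δ≡βγ (trans (cong (β *ᵍ_) γ≡θη) (*ᵍ-θʳ β η))) δ≢0 g)
G-divisor-θ zero β γ refl δ≢0 g = contradiction (cong θ (G₀-θ {β *ᵍ γ} g)) δ≢0
G-divisor-θ (suc n) β γ refl δ≢0 g = even β refl β∈G , G-suc n β∈G
  where
  β∈G : G n β
  β∈G = G-divisor n β γ refl (λ eq → δ≢0 (cong θ eq)) (G-θ⁻¹ n {β *ᵍ γ} g)

-- From representatives modulo `β` to membership of `β`.

θ^ : ℕ → ℤ[i]
θ^ zero = 1ᵍ
θ^ (suc n) = θ (θ^ n)

θ^-oct : ∀ n → Oct (d n) (d (suc n)) (θ^ (suc n))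
θ^-oct zero = oct-θ (A₀⇒oct (is1 refl))
θ^-oct (suc n) = oct-θ (θ^-oct n)

-- Dividing by `1 + i` once per level would put `1 + i` itself into `A₀`.
θ^∉G : ∀ n → ¬ G n (θ^ (suc n))
θ^∉G zero (small a) with () ← G₀-θ {1ᵍ} (small a)
θ^∉G (suc n) g = θ^∉G n (G-θ⁻¹ n g)

-ᵍ-θ : ∀ z z′ → θ z -ᵍ θ z′ ≡ θ (z -ᵍ z′)
-ᵍ-θ (a + b i) (c + e i) = cong₂ _+_i (re-eq a b c e) (im-eq a b c e)
  where
  re-eq : ∀ a b c e → (a - b) - (c - e) ≡ (a - c) - (b - e)
  re-eq = solve-∀
  im-eq : ∀ a b c e → (a + b) - (c + e) ≡ (a - c) + (b - e)
  im-eq = solve-∀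

-ᵍ≡0 : ∀ z z′ → z -ᵍ z′ ≡ 0ᵍ → z ≡ z′
-ᵍ≡0 (a + b i) (c + e i) eq = cong₂ _+_i (i-j≡0⇒i≡j a c (cong re eq)) (i-j≡0⇒i≡j b e (cong im eq))

oct-- : ∀ {M S M′ S′ z z′} → Oct M S z → Oct M′ S′ z′ → Oct (M + M′) (S + S′) (z -ᵍ z′)
oct-- o o′ = oct-+ o (oct-rot (oct-rot o′))

-- For odd `m` the octagons add up to exactly the next one, as `w n + d n = w (n + 1)`. For even `m`
-- a factor `1 + i` is taken out of both terms and the level drops.
θ^-minus-G : ∀ n {m} → G n m → G (suc n) (θ^ (suc n) -ᵍ m)
θ^-minus-G n {m} g with odd⊎even m
... | inj₁ m-odd = odd (odd-θ+ (θ^ n) (rot (rot m)) (odd-rot (rot m) (odd-rot m m-odd)))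
  (oct-mono (≤-reflexive (trans (lemma (d n) (w n) (+ 2)) (cong (_- + 2) (sym (w-suc n)))))
    (≤-reflexive (trans (lemma (d (suc n)) (w (suc n)) (+ 3)) (cong (_- + 3) (sym (w-suc (suc n))))))
    (oct-- (θ^-oct n) (G⇒oct n g)))
  where
  lemma : ∀ d w c → d + (w - c) ≡ w + d - c
  lemma = solve-∀
-- At level 0 the only even `m` is 0, which leaves `1 + i` itself.
θ^-minus-G zero g | inj₂ (η , refl) with refl ← G₀-θ {η} g = even 1ᵍ refl (small (is1 refl))
θ^-minus-G (suc n) g | inj₂ (η , refl) =
  even _ (-ᵍ-θ (θ^ (suc n)) η) (θ^-minus-G n (G-θ⁻¹ n g))

↠⇒G : ∀ n β → G n ↠mod β → G (suc n) β
-- This power just misses `G n`, so it differs from its representative, yet it is small enough to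
-- keep the difference in `G (n + 1)`.
↠⇒G n β G↠β with G↠β (θ^ (suc n))
... | m , m∈G , γ , eq = G-divisor (suc n) β γ eq
  (λ δ≡0 → θ^∉G n (subst (G n) (sym (-ᵍ≡0 _ _ δ≡0)) m∈G))
  (θ^-minus-G n m∈G)

-- Representatives modulo β

odd⇒θ+1 : ∀ z → Odd z → ∃[ η ] z ≡ θ η +ᵍ 1ᵍ
odd⇒θ+1 (x + y i) (k , eq) with odd⊎even ((x - 1ℤ) + y i)
... | inj₁ (k′ , eq′) = contradiction (trans (sym even′) eq′) (m+m≢1+n+n k k′)
  where
  move : ∀ x y → (x - 1ℤ) + y ≡ (x + y) - 1ℤ
  move = solve-∀
  cancel : ∀ k → (1ℤ + (k + k)) - 1ℤ ≡ k + k
  cancel = solve-∀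
  even′ : (x - 1ℤ) + y ≡ k + k
  even′ = trans (move x y) (trans (cong (_- 1ℤ) eq) (cancel k))
... | inj₂ (u + v i , eq′) = u + v i , cong₂ _+_i
  (trans (restore x) (cong (_+ 1ℤ) (cong re eq′))) (trans (sym (+-identityʳ y)) (cong (_+ 0ℤ) (cong im eq′)))
  where
  restore : ∀ x → x ≡ (x - 1ℤ) + 1ℤ
  restore = solve-∀

-- Every `α` is `θ ζ` or `θ ζ + 1`: a class mod `η` splits into two mod `θ η`, told apart by the
-- last digit in base `1 + i`.
↠-θ : ∀ {M N : ℤ[i] → Set} η → M ↠mod η →
  (∀ m → M m → N (θ m) × N (θ m +ᵍ 1ᵍ)) → N ↠mod θ η
↠-θ {M} {N} η M↠η digits α with odd⊎even α
... | inj₂ (ζ , refl) =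
  let m , m∈M , γ , eq = M↠η ζ
  in θ m , proj₁ (digits m m∈M) , γ ,
     trans (-ᵍ-θ ζ m) (trans (cong θ eq) (sym (*ᵍ-θˡ η γ)))
... | inj₁ α-odd with odd⇒θ+1 α α-odd
... | ζ , refl =
  let m , m∈M , γ , eq = M↠η ζ
  in θ m +ᵍ 1ᵍ , proj₂ (digits m m∈M) , γ ,
     trans (cancel (θ ζ) (θ m)) (trans (-ᵍ-θ ζ m) (trans (cong θ eq) (sym (*ᵍ-θˡ η γ))))
  where
  cancel : ∀ z z′ → (z +ᵍ 1ᵍ) -ᵍ (z′ +ᵍ 1ᵍ) ≡ z -ᵍ z′
  cancel (a + b i) (c + e i) = cong₂ _+_i (lemma a c 1ℤ) (lemma b e 0ℤ)
    where
    lemma : ∀ a c t → (a + t) - (c + t) ≡ a - c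
    lemma = solve-∀

-- The offsets 2 and 3 of the octagon are tuned for this: `θ` leaves one unit of room on every side,
-- and adding 1 uses it up exactly.
digit : ∀ n m → G n m → G (suc n) (θ m) × G (suc n) (θ m +ᵍ 1ᵍ)
digit n m g = even m refl g , odd (odd-θ+ m 1ᵍ (0ℤ , refl))
  (oct-mono (≤-reflexive (lemma₁ (w (suc n)))) (≤-reflexive (lemma₂ (w n)))
    (oct-+ (oct-θ (G⇒oct n g)) (A₀⇒oct (is1 refl))))
  where
  lemma₁ : ∀ a → (a - + 3) + 1ℤ ≡ a - + 2
  lemma₁ = solve-∀
  lemma₂ : ∀ a → ((a - + 2) + (a - + 2)) + 1ℤ ≡ (a + a) - + 3
  lemma₂ = solve-∀

↠-unrot : ∀ {M} β → M ↠mod rot β → M ↠mod β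
↠-unrot β M↠rotβ α =
  let m , m∈M , γ , eq = M↠rotβ α
  in m , m∈M , rot γ , trans eq (trans (*ᵍ-comm (rot β) γ)
       (trans (*ᵍ-rot γ β) (trans (cong rot (*ᵍ-comm γ β)) (sym (*ᵍ-rot β γ)))))

unit⇒↠ : ∀ {η} → A₀ η → η ≡ 0ᵍ ⊎ (_≡ 0ᵍ) ↠mod η
unit⇒↠ (is0 p) = inj₁ p
unit⇒↠ (is1 refl) = inj₂ 0↠1
  where
  0↠1 : (_≡ 0ᵍ) ↠mod 1ᵍ
  0↠1 (x + y i) = 0ᵍ , refl , (x + y i) , cong₂ _+_i (re-eq x y) (im-eq x y)
    where
    re-eq : ∀ x y → x - 0ℤ ≡ 1ℤ * x - 0ℤ * y
    re-eq = solve-∀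
    im-eq : ∀ x y → y - 0ℤ ≡ 1ℤ * y + 0ℤ * x
    im-eq = solve-∀
unit⇒↠ (is--i refl) with inj₂ h ← unit⇒↠ (is1 refl) = inj₂ (↠-unrot (0ℤ + -1ℤ i) h)
unit⇒↠ (is-1 refl) with inj₂ h ← unit⇒↠ (is1 refl) = inj₂ (↠-unrot (-1ℤ + 0ℤ i) (↠-unrot (0ℤ + -1ℤ i) h))
unit⇒↠ (is-i refl) with inj₂ h ← unit⇒↠ (is1 refl) = inj₂ (↠-unrot (0ℤ + 1ℤ i) (↠-unrot (-1ℤ + 0ℤ i) (↠-unrot (0ℤ + -1ℤ i) h)))

-- Points too divisible to lie in `G n`.

oct-quadrant : ∀ {M S x y} → 0ℤ ≤ x → 0ℤ ≤ y → x ≤ M → y ≤ M → x + y ≤ S → Oct M S (x + y i)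
oct-quadrant {M} {S} {x} {y} 0≤x 0≤y x≤M y≤M x+y≤S = oct₈⇒oct (oct₈
  x≤M (linear (x≤M ⊕ 0≤x ⊕ 0≤x) 0 (solve (x ∷ M ∷ [])))
  y≤M (linear (y≤M ⊕ 0≤y ⊕ 0≤y) 0 (solve (y ∷ M ∷ [])))
  x+y≤S (linear (x+y≤S ⊕ 0≤x ⊕ 0≤x) 0 (solve (x ∷ y ∷ S ∷ [])))
  (linear (x+y≤S ⊕ 0≤y ⊕ 0≤y) 0 (solve (x ∷ y ∷ S ∷ [])))
  (linear (x+y≤S ⊕ 0≤x ⊕ 0≤x ⊕ 0≤y ⊕ 0≤y) 0 (solve (x ∷ y ∷ S ∷ []))))

-- The points of the sector 0 ≤ x ≤ y that are in the octagon but too divisible to be in G n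
-- satisfy these inequalities, which are invariant under (n , x , y) ↦ (n + 2 , 2x , 2y).
record Deep (W D x y : ℤ) : Set where
  constructor deep
  field
    d≤y : D ≤ y
    w-d≤x+y : W - D ≤ x + y
    d≤x : 1ℤ + (y - W + D) ≤ x → D ≤ x

deep-double : ∀ {W D x y} → Deep W D x y → Deep (W + W) (D + D) (x + x) (y + y)
deep-double {W} {D} {x} {y} (deep p q r) = deep (p ⊕ p)
  (linear (q ⊕ q) 0 (solve (W ∷ D ∷ x ∷ y ∷ [])))
  -- For integers, `2 (y - W + D) < 2 x` gives back `y - W + D < x`.
  (λ h → let D≤x = r (≤-by-contradiction λ x< → 1≰0
                (linear (h ⊕ x< ⊕ x<) 0 (solve (W ∷ D ∷ x ∷ y ∷ []))))
         in D≤x ⊕ D≤x)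

-- The alternatives negate `y ≤ w n - 2` and `x + y ≤ w (n + 1) - 3`, the only sides of the octagon
-- that can cut off a point of the sector.
near-boundary⇒deep : ∀ {W D x y} → 1ℤ ≤ D → D + D ≤ W → 0ℤ ≤ x → x ≤ y →
  W - 1ℤ ≤ y ⊎ W + D - + 2 ≤ x + y → Deep W D x y
near-boundary⇒deep {W} {D} {x} {y} 1≤D 2D≤W 0≤x x≤y (inj₁ b) = deep
  (linear (b ⊕ 2D≤W ⊕ 1≤D) 0 (solve (W ∷ D ∷ x ∷ y ∷ [])))
  (linear (b ⊕ 0≤x ⊕ 1≤D) 0 (solve (W ∷ D ∷ x ∷ y ∷ [])))
  (λ h → linear (h ⊕ b) 0 (solve (W ∷ D ∷ x ∷ y ∷ [])))
near-boundary⇒deep {W} {D} {x} {y} 1≤D 2D≤W 0≤x x≤y (inj₂ b) = deep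
  (≤-by-contradiction λ y<D → 1≰0
    (linear (y<D ⊕ y<D ⊕ x≤y ⊕ b ⊕ 2D≤W ⊕ 1≤D) 0 (solve (W ∷ D ∷ x ∷ y ∷ []))))
  (linear (b ⊕ 1≤D ⊕ 1≤D) 0 (solve (W ∷ D ∷ x ∷ y ∷ [])))
  (λ h → ≤-by-contradiction λ x<D → 1≰0
    (linear (h ⊕ b ⊕ x<D ⊕ x<D) 0 (solve (W ∷ D ∷ x ∷ y ∷ []))))

odd⇒G⊎deep : ∀ n x y → 0ℤ ≤ x → x ≤ y → Odd (x + y i) → G n (x + y i) ⊎ Deep (w n) (d n) x y
odd⇒G⊎deep n x y 0≤x x≤y z-odd with ≤⊎> y (w n - + 2) | ≤⊎> (x + y) (w (suc n) - + 3)
... | inj₁ y≤M | inj₁ x+y≤S =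
  inj₁ (odd-oct⇒G n z-odd (oct-quadrant 0≤x (≤-trans 0≤x x≤y) (≤-trans x≤y y≤M) y≤M x+y≤S))
... | inj₂ M<y | _ = inj₂ (near-boundary⇒deep (1≤d n) (2d≤w n) 0≤x x≤y
  (inj₁ (subst (_≤ y) (lemma (w n)) M<y)))
  where
  lemma : ∀ W → 1ℤ + (W - + 2) ≡ W - 1ℤ
  lemma = solve-∀
... | inj₁ _ | inj₂ S<x+y = inj₂ (near-boundary⇒deep (1≤d n) (2d≤w n) 0≤x x≤y
  (inj₂ (subst (_≤ x + y) (trans (lemma (w (suc n))) (cong (_- + 2) (w-suc n))) S<x+y)))
  where
  lemma : ∀ T → 1ℤ + (T - + 3) ≡ T - + 2
  lemma = solve-∀

-- Through `θ` the sides swap roles: `u` is half of `x + y`, and `u + v` is `y`.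
θ-odd⇒G⊎deep : ∀ n u v → 0ℤ ≤ u - v → u - v ≤ u + v → Odd (u + v i) →
  G (suc n) (θ (u + v i)) ⊎ Deep (w (suc n)) (d (suc n)) (u - v) (u + v)
θ-odd⇒G⊎deep n u v 0≤x x≤y η-odd@(k , u+v≡1+2k) with ≤⊎> u (w n - + 2) | ≤⊎> (u + v) (w (suc n) - + 3)
... | inj₁ u≤M | inj₁ u+v≤S =
  inj₁ (even (u + v i) refl (odd-oct⇒G n η-odd (oct-quadrant (0≤u 0≤x 0≤v) 0≤v u≤M (≤-trans (v≤u 0≤x) u≤M) u+v≤S)))
  where
  0≤v : 0ℤ ≤ v
  0≤v = double-cancel-≤ (linear x≤y 0 (solve (u ∷ v ∷ [])))
  0≤u : 0ℤ ≤ u - v → 0ℤ ≤ v → 0ℤ ≤ u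
  0≤u p q = linear (p ⊕ q) 0 (solve (u ∷ v ∷ []))
  v≤u : 0ℤ ≤ u - v → v ≤ u
  v≤u p = linear p 0 (solve (u ∷ v ∷ []))
... | inj₂ M<u | _ = inj₂ (near-boundary⇒deep (1≤d (suc n)) (2d≤w (suc n)) 0≤x x≤y
  (inj₂ (subst (λ t → t - + 2 ≤ (u - v) + (u + v)) (w-suc (suc n)) (bound (w n) M<u))))
  where
  bound : ∀ W → 1ℤ + (W - + 2) ≤ u → (W + W) - + 2 ≤ (u - v) + (u + v)
  bound W p = linear (p ⊕ p) 0 (solve (W ∷ u ∷ v ∷ []))
-- `y = u + v` is odd and `w (n + 1)` is even, so `y ≥ w (n + 1) - 2` sharpens to
-- `y ≥ w (n + 1) - 1`.
... | inj₁ _ | inj₂ S<u+v = inj₂ (near-boundary⇒deep (1≤d (suc n)) (2d≤w (suc n)) 0≤x x≤y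
  (inj₁ (subst₂ (λ s t → s - 1ℤ ≤ t) (sym (proj₂ (w-even n))) (sym u+v≡1+2k)
    (bound (proj₁ (w-even n)) k (subst₂ (λ s t → 1ℤ + (s - + 3) ≤ t) (proj₂ (w-even n)) u+v≡1+2k S<u+v)))))
  where
  bound : ∀ h k → 1ℤ + (h + h - + 3) ≤ 1ℤ + (k + k) → h + h - 1ℤ ≤ 1ℤ + (k + k)
  bound h k p = linear (h-1≤k ⊕ h-1≤k) 0 (solve (h ∷ k ∷ []))
    where
    h-1≤k : h - 1ℤ ≤ k
    h-1≤k = ≤-by-contradiction λ k< → 1≰0 (linear (p ⊕ k< ⊕ k<) 0 (solve (h ∷ k ∷ [])))

θ²⇒double : ∀ p q → θ (θ (p + q i)) ≡ (- q + - q) + (p + p) i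
θ²⇒double p q = cong₂ _+_i (re-eq p q) (im-eq p q)
  where
  re-eq : ∀ p q → (p - q) - (p + q) ≡ - q + - q
  re-eq = solve-∀
  im-eq : ∀ p q → (p - q) + (p + q) ≡ p + p
  im-eq = solve-∀

double≡θ² : ∀ {x y p q} → (x + y i) ≡ θ (θ (p + q i)) → x ≡ - q + - q × y ≡ p + p
double≡θ² {p = p} {q} eq = cong re eq′ , cong im eq′
  where eq′ = trans eq (θ²⇒double p q)

-- Two factors `1 + i` amount to `2 i`: a point divisible by 2 is halved, the level drops by 2, and
-- `Deep` is carried back up by doubling.
G⊎deep : ∀ n x y → 0ℤ ≤ x → x ≤ y → G n (x + y i) ⊎ Deep (w n) (d n) x y
G⊎deep zero x y 0≤x x≤y with ≤⊎> (x + y) 1ℤ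
... | inj₁ x+y≤1 = inj₁ (small (oct11⇒A₀ (oct-quadrant 0≤x 0≤y (≤-trans x≤y y≤1) y≤1 x+y≤1)))
  where
  0≤y : 0ℤ ≤ y
  0≤y = ≤-trans 0≤x x≤y
  y≤1 : y ≤ 1ℤ
  y≤1 = linear (x+y≤1 ⊕ 0≤x) 0 (solve (x ∷ y ∷ []))
... | inj₂ 2≤x+y = inj₂ (near-boundary⇒deep (1≤d 0) (2d≤w 0) 0≤x x≤y (inj₂ 2≤x+y))
G⊎deep (suc n) x y 0≤x x≤y with odd⊎even (x + y i)
... | inj₁ z-odd = odd⇒G⊎deep (suc n) x y 0≤x x≤y z-odd
... | inj₂ (u + v i , refl) with odd⊎even (u + v i)
... | inj₁ η-odd = θ-odd⇒G⊎deep n u v 0≤x x≤y η-odd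
... | inj₂ (p + q i , refl) with double≡θ² {p = p} {q} refl
... | x≡ , y≡ = halved n (subst (0ℤ ≤_) x≡ 0≤x) (subst₂ _≤_ x≡ y≡ x≤y)
  where
  halved : ∀ n → 0ℤ ≤ - q + - q → - q + - q ≤ p + p →
    G (suc n) (θ (θ (p + q i))) ⊎ Deep (w (suc n)) (d (suc n)) ((p - q) - (p + q)) ((p - q) + (p + q))
  -- The only multiple of 2 in `G 1` is 0. Here `p ≤ 0` forces the point to be 0, and every other
  -- one is `Deep` outright for `w 1 = 4` and `d 1 = 2`.
  halved zero 0≤2x′ 2x′≤2y′ with ≤⊎> p 0ℤ
  ... | inj₁ p≤0 = inj₁ (subst (G 1) (sym (trans (θ²⇒double p q) (cong₂ _+_i (cong₂ _+_ -q≡0 -q≡0) (cong₂ _+_ p≡0 p≡0)))) (G-0 1))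
    where
    0≤-q : 0ℤ ≤ - q
    0≤-q = double-cancel-≤ 0≤2x′
    -q≤p : - q ≤ p
    -q≤p = double-cancel-≤ 2x′≤2y′
    p≡0 : p ≡ 0ℤ
    p≡0 = ≤-antisym p≤0 (≤-trans 0≤-q -q≤p)
    -q≡0 : - q ≡ 0ℤ
    -q≡0 = ≤-antisym (≤-trans -q≤p p≤0) 0≤-q
  ... | inj₂ 0<p = inj₂ (subst₂ (Deep (+ 4) (+ 2)) (sym x≡) (sym y≡)
    (deep (0<p ⊕ 0<p) (0≤2x′ ⊕ (0<p ⊕ 0<p)) λ h → 1≤-q h ⊕ 1≤-q h))
    where
    1≤-q : 1ℤ + (p + p - + 4 + + 2) ≤ - q + - q → 1ℤ ≤ - q
    1≤-q h = ≤-by-contradiction λ -q<1 → 1≰0 (linear (h ⊕ -q<1 ⊕ -q<1 ⊕ 0<p ⊕ 0<p) 0 (solve (p ∷ q ∷ [])))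
  halved (suc n) 0≤2x′ 2x′≤2y′ with G⊎deep n (- q) p (double-cancel-≤ 0≤2x′) (double-cancel-≤ 2x′≤2y′)
  -- The halved point `- q + p i` is `rot (p + q i)`.
  ... | inj₁ g = inj₁ (even _ refl (even _ refl (G-unrot n g)))
  ... | inj₂ r = inj₂ (subst₂ (Deep (w n + w n) (d n + d n)) (sym x≡) (sym y≡) (deep-double r))

-- Symmetry reductions and shifts by unit multiples of `β`.

sector-induction : (P : ℤ[i] → Set) → (∀ z → P (rot z) → P z) →
  (∀ x y → - y ≤ x → x ≤ y → P (x + y i)) → ∀ z → P z
sector-induction P unrot top (x + y i) with ≤⊎> x y | ≤⊎> (- y) x
... | inj₁ x≤y | inj₁ -y≤x = top x y -y≤x x≤y
... | inj₂ y<x | inj₁ -y≤x = unrot _ (top (- y) x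
  (linear y<x 1 (solve (x ∷ y ∷ []))) -y≤x)
... | inj₂ y<x | inj₂ x<-y = unrot _ (unrot _ (top (- x) (- y)
  (linear x<-y 1 (solve (x ∷ y ∷ []))) (linear y<x 1 (solve (x ∷ y ∷ [])))))
... | inj₁ x≤y | inj₂ x<-y = unrot _ (unrot _ (unrot _ (top (- - y) (- x)
  (linear x≤y 0 (solve (x ∷ y ∷ []))) (linear x<-y 1 (solve (x ∷ y ∷ []))))))

mirror : ℤ[i] → ℤ[i]
mirror (x + y i) = (- x) + y i

mirror≡ : ∀ z → mirror z ≡ rot (rot (conj z))
mirror≡ (x + y i) = cong ((- x) +_i) (sym (neg-involutive y))

oct-mirror : ∀ {M S} z → Oct M S z → Oct M S (mirror z)
oct-mirror {M} {S} z o = subst (Oct M S) (sym (mirror≡ z)) (oct-rot (oct-rot (oct-conj o)))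

G-mirror : ∀ n z → G n z → G n (mirror z)
G-mirror n z g = subst (G n) (sym (mirror≡ z)) (G-rot n (G-rot n (G-conj n g)))

-- Every diagonal side bounds a form congruent to `x + y` mod 2, so an odd point never attains an
-- even bound.
oct-odd : ∀ {M h z} → Odd z → Oct M (h + h) z → Oct M (h + h - 1ℤ) z
oct-odd {M} {h} z-odd o = oct-coind (λ z → Odd z × Oct M (h + h) z)
  (λ { z ((k , eq) , o) → proj₁ (Oct.half o 0) ,
       subst (_≤ h + h - 1ℤ) (sym eq) (tighten k (subst (_≤ h + h) eq (proj₂ (Oct.half o 0)))) })
  (λ { z (z-odd , o) → odd-rot z z-odd , oct-rot o }) (z-odd , o)
  where
  tighten : ∀ k → 1ℤ + (k + k) ≤ h + h → 1ℤ + (k + k) ≤ h + h - 1ℤ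
  tighten k p = linear (k<h ⊕ k<h) 0 (solve (h ∷ k ∷ []))
    where
    k<h : 1ℤ + k ≤ h
    k<h = ≤-by-contradiction λ h≤k → 1≰0 (linear (p ⊕ h≤k ⊕ h≤k) 0 (solve (h ∷ k ∷ [])))

-- β = b + a i and ζ = x + y i lie in the sector |re| ≤ im; W = w n, D = d n, T = w (n + 1) = W + D.
module Shift {W D a x y : ℤ} (1≤D : 1ℤ ≤ D) (2D≤W : D + D ≤ W) (a≤T-2 : a ≤ W + D - + 2)
  (0≤x : 0ℤ ≤ x) (x≤y : x ≤ y) (x+y<a : x + y ≤ a - 1ℤ) (z-deep : Deep W D x y) where

  open Deep z-deep

  0≤W-2 : 0ℤ ≤ W - + 2
  0≤W-2 = linear (2D≤W ⊕ 1≤D ⊕ 1≤D) 0 (solve (W ∷ D ∷ []))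
  0≤y : 0ℤ ≤ y
  0≤y = ≤-trans 0≤x x≤y
  a-y≤W-2 : a - y ≤ W - + 2
  a-y≤W-2 = linear (a≤T-2 ⊕ d≤y) 0 (solve (W ∷ D ∷ a ∷ y ∷ []))
  y≤a : y ≤ a
  y≤a = linear (x+y<a ⊕ 0≤x) 1 (solve (x ∷ y ∷ a ∷ []))

  -- With `b ≥ 0`, `β` leans to the same side as `ζ`, and `ζ - β` has room on every side.
  shift-β : ∀ {b} → 0ℤ ≤ b → b ≤ a - 1ℤ → b + a ≤ W + W - + 3 →
    Oct (W - + 2) (W + D - + 2) ((x - b) + (y - a) i)
  shift-β {b} 0≤b b<a b+a≤2W-3 = oct₈⇒oct (oct₈
    (linear (x+y<a ⊕ d≤y ⊕ a≤T-2 ⊕ 0≤b) 1 (solve (x ∷ y ∷ a ∷ b ∷ W ∷ D ∷ [])))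
    (linear (0≤x ⊕ b≤W-2) 0 (solve (x ∷ b ∷ W ∷ [])))
    (linear (y≤a ⊕ 0≤W-2) 0 (solve (y ∷ a ∷ W ∷ [])))
    (linear a-y≤W-2 0 (solve (y ∷ a ∷ W ∷ [])))
    (linear (x+y<a ⊕ 0≤b ⊕ 0≤W-2 ⊕ 1≤D) 2 (solve (x ∷ y ∷ a ∷ b ∷ W ∷ D ∷ [])))
    (linear (0≤x ⊕ b≤W-2 ⊕ y≤a ⊕ 1≤D) 1 (solve (x ∷ y ∷ a ∷ b ∷ W ∷ D ∷ [])))
    (linear (x≤y ⊕ 0≤b ⊕ a≤T-2) 0 (solve (x ∷ y ∷ a ∷ b ∷ W ∷ D ∷ [])))
    (linear (b+a≤2W-3 ⊕ w-d≤x+y) 1 (solve (x ∷ y ∷ a ∷ b ∷ W ∷ D ∷ []))))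
    where
    b≤W-2 : b ≤ W - + 2
    b≤W-2 = ≤-by-contradiction λ p → 1≰0 (linear (p ⊕ p ⊕ b<a ⊕ b+a≤2W-3) 1 (solve (a ∷ b ∷ W ∷ [])))

  module _ {c} (0≤c : 0ℤ ≤ c) (c<a : c ≤ a - 1ℤ) (c+a≤2W-3 : c + a ≤ W + W - + 3)
    (2y<c+a : y + y ≤ c + a - 1ℤ) where

    y≤W-2 : y ≤ W - + 2
    y≤W-2 = double-cancel-≤ (linear (2y<c+a ⊕ c+a≤2W-3) 0 (solve (y ∷ a ∷ c ∷ W ∷ [])))
    c≤W-2 : c ≤ W - + 2
    c≤W-2 = ≤-by-contradiction λ p → 1≰0 (linear (p ⊕ p ⊕ c<a ⊕ c+a≤2W-3) 1 (solve (a ∷ c ∷ W ∷ [])))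
    x≤a : x ≤ a
    x≤a = ≤-trans x≤y y≤a

    shift-by-a : - (x - a) ≤ W - + 2 → - (x - a) + (y - c) ≤ W + D - + 2 →
      Oct (W - + 2) (W + D - + 2) ((x - a) + (y - c) i)
    shift-by-a a-x≤W-2 -x+a+y-c≤ = oct₈⇒oct (oct₈
      (linear (x≤a ⊕ 0≤W-2) 0 (solve (x ∷ a ∷ W ∷ [])))
      a-x≤W-2
      (linear (y≤W-2 ⊕ 0≤c) 0 (solve (y ∷ c ∷ W ∷ [])))
      (linear (c≤W-2 ⊕ 0≤y) 0 (solve (y ∷ c ∷ W ∷ [])))
      (linear (x≤a ⊕ y≤W-2 ⊕ 0≤c ⊕ 1≤D) 1 (solve (x ∷ y ∷ a ∷ c ∷ W ∷ D ∷ [])))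
      -x+a+y-c≤
      (linear (x≤a ⊕ 0≤y ⊕ c≤W-2 ⊕ 1≤D) 1 (solve (x ∷ y ∷ a ∷ c ∷ W ∷ D ∷ [])))
      (linear (c+a≤2W-3 ⊕ w-d≤x+y) 1 (solve (x ∷ y ∷ a ∷ c ∷ W ∷ D ∷ []))))

    -- For `b = - c`. Here `ζ - β` can stick out only on the right or the lower right; if it does,
    -- `ζ + i β = (x - a) + (y - c) i` stays inside.
    shift-±β : Oct (W - + 2) (W + D - + 2) ((x + c) + (y - a) i) ⊎
      Oct (W - + 2) (W + D - + 2) ((x - a) + (y - c) i)
    shift-±β with ≤⊎> (x + c) (W - + 2) | ≤⊎> ((x + c) - (y - a)) (W + D - + 2)
    ... | inj₁ x+c≤ | inj₁ x+c+a-y≤ = inj₁ (oct₈⇒oct (oct₈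
      x+c≤
      (linear (0≤x ⊕ 0≤c ⊕ 0≤W-2) 0 (solve (x ∷ c ∷ W ∷ [])))
      (linear (y≤a ⊕ 0≤W-2) 0 (solve (y ∷ a ∷ W ∷ [])))
      (linear a-y≤W-2 0 (solve (y ∷ a ∷ W ∷ [])))
      (linear (y≤a ⊕ x+c≤ ⊕ 1≤D) 1 (solve (x ∷ y ∷ a ∷ c ∷ W ∷ D ∷ [])))
      (linear (y≤a ⊕ 0≤x ⊕ 0≤c ⊕ 0≤W-2 ⊕ 1≤D) 1 (solve (x ∷ y ∷ a ∷ c ∷ W ∷ D ∷ [])))
      x+c+a-y≤
      (linear (0≤x ⊕ 0≤c ⊕ 0≤y ⊕ a≤T-2) 0 (solve (x ∷ y ∷ a ∷ c ∷ W ∷ D ∷ [])))))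
    ... | inj₂ x+c> | _ = inj₂ (shift-by-a
      (linear (c+a≤2W-3 ⊕ x+c>) 0 (solve (x ∷ c ∷ a ∷ W ∷ [])))
      (linear (a≤T-2 ⊕ x+c> ⊕ y≤W-2) 1 (solve (x ∷ y ∷ a ∷ c ∷ W ∷ D ∷ []))))
    -- The violated side gives `x > y - W + D`, the premise of the last field of `Deep`. That field
    -- returns `D ≤ x`, hence `a - x ≤ W - 2`.
    ... | inj₁ _ | inj₂ x+c+a-y> = inj₂ (shift-by-a
      (linear (a≤T-2 ⊕ D≤x) 0 (solve (x ∷ a ∷ W ∷ D ∷ [])))
      (linear (a≤T-2 ⊕ a≤T-2 ⊕ x+c+a-y>) 1 (solve (x ∷ y ∷ a ∷ c ∷ W ∷ D ∷ []))))
      where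
      D≤x : D ≤ x
      D≤x = d≤x (linear (x+c+a-y> ⊕ c+a≤2W-3) 1 (solve (x ∷ y ∷ a ∷ c ∷ W ∷ D ∷ [])))

-- Reduction into the fundamental square.

centred-remainder : ∀ p h → 0ℤ ≤ h → ∃[ q ] (p - q * (1ℤ + (h + h)) ≤ h × - (p - q * (1ℤ + (h + h))) ≤ h)
centred-remainder p (+ h) _ = q ,
  subst (_≤ + h) (sym p-qN) (upper (+≤+ (ℕ.m<1+n⇒m≤n (n%ℕd<d (p + + h) N)))) ,
  subst (λ t → - t ≤ + h) (sym p-qN) (lower (+≤+ z≤n))
  where
  N : ℕ
  N = suc (h +ℕ h)
  q : ℤ
  -- Dividing `p + h` instead of `p` moves the remainders from `0 … 2 h` to `- h … h`.
  q = (p + + h) /ℕ N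
  r : ℤ
  r = + ((p + + h) %ℕ N)
  move : ∀ p h t → p - t ≡ (p + h) - t - h
  move = solve-∀
  cancel : ∀ r t h → (r + t) - t - h ≡ r - h
  cancel = solve-∀
  p-qN : p - q * + N ≡ r - + h
  p-qN = trans (move p (+ h) (q * + N))
    (trans (cong (λ t → t - q * + N - + h) (a≡a%ℕn+[a/ℕn]*n (p + + h) N)) (cancel r (q * + N) (+ h)))
  upper : r ≤ + h + + h → r - + h ≤ + h
  upper = helper r (+ h)
    where
    helper : ∀ r h → r ≤ h + h → r - h ≤ h
    helper r h p = linear p 0 (solve (r ∷ h ∷ []))
  lower : 0ℤ ≤ r → - (r - + h) ≤ + h
  lower = helper r (+ h)
    where
    helper : ∀ r h → 0ℤ ≤ r → - (r - h) ≤ h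
    helper r h p = linear p 0 (solve (r ∷ h ∷ []))

-- The square with vertices ±β(1 ± i)/2 lies in the octagon |x|, |y| < (a + c)/2, |x| + |y| < a.
module FundamentalSquare {a b c h m : ℤ} (b≤c : b ≤ c) (-b≤c : - b ≤ c) (c<a : c ≤ a - 1ℤ) (1≤a : 1ℤ ≤ a) (0≤m : 0ℤ ≤ m)
  (a+c≡1+2m : a + c ≡ 1ℤ + (m + m)) (0≤h : 0ℤ ≤ h) (norm≡1+2h : b * b + a * a ≡ 1ℤ + (h + h)) where

  -- The equations say `N z = β (p + r i)` for the norm `N = 1 + 2 h`, so the coordinates of `z / β`
  -- are at most `h / N < 1/2` in absolute value.
  record Square (z : ℤ[i]) : Set where
    constructor square
    field
      p r : ℤ
      p≤h : p ≤ h
      -p≤h : - p ≤ h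
      r≤h : r ≤ h
      -r≤h : - r ≤ h
      re≡ : (1ℤ + (h + h)) * re z ≡ p * b - r * a
      im≡ : (1ℤ + (h + h)) * im z ≡ p * a + r * b

  -- `2 N x ≤ 2 h (a + c) < N (1 + 2 m)` and `N (x + y) = p (a + b) - r (a - b) ≤ 2 h a < N a`.
  square⇒half : ∀ z → Square z → Half m (a - 1ℤ) z
  square⇒half (x + y i) (square p r p≤h -p≤h r≤h -r≤h re≡ im≡) = re-bound , sum-bound
    where
    0≤1+2h : 0ℤ ≤ 1ℤ + (h + h)
    0≤1+2h = +≤+ {0} {1} z≤n ⊕ (0≤h ⊕ 0≤h)
    expand-a+c : (h + h) * (a + c) ≡ (h + h) * (1ℤ + (m + m))
    expand-a+c = cong ((h + h) *_) a+c≡1+2m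
    0≤a : 0ℤ ≤ a
    0≤a = ≤-trans (+≤+ z≤n) 1≤a
    Nx≤ : (1ℤ + (h + h)) * x + (1ℤ + (h + h)) * x ≤ (h + h) * (a + c)
    -- `(h - p) (c + b) + (h + p) (c - b) = 2 (h c - p b)` yields `p b ≤ h c` whatever the signs.
    Nx≤ = linear (0≤* (i≤j⇒0≤j-i p≤h) (i≤j⇒0≤j-i -b≤c) ⊕ 0≤* (i≤j⇒0≤j-i -p≤h) (i≤j⇒0≤j-i b≤c)
      ⊕ 0≤* (i≤j⇒0≤j-i -r≤h) 0≤a ⊕ 0≤* (i≤j⇒0≤j-i -r≤h) 0≤a ⊕ ≤-reflexive re≡ ⊕ ≤-reflexive re≡) 0
      (solve (x ∷ a ∷ b ∷ c ∷ h ∷ p ∷ r ∷ []))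
    re-bound : x ≤ m
    re-bound = ≤-by-contradiction λ m<x → 1≰0 (linear
      (Nx≤ ⊕ ≤-reflexive expand-a+c ⊕ 0≤* 0≤1+2h (i≤j⇒0≤j-i m<x) ⊕ 0≤* 0≤1+2h (i≤j⇒0≤j-i m<x)
        ⊕ 0≤h ⊕ 0≤h ⊕ 0≤m ⊕ 0≤m) 1 (solve (x ∷ a ∷ c ∷ h ∷ m ∷ [])))
    sum-bound : x + y ≤ a - 1ℤ
    sum-bound = ≤-by-contradiction λ a≤x+y → 1≰0 (linear
      (0≤* (i≤j⇒0≤j-i p≤h) 0≤a+b ⊕ 0≤* (i≤j⇒0≤j-i -r≤h) 0≤a-b ⊕ ≤-reflexive re≡ ⊕ ≤-reflexive im≡
        ⊕ 0≤* 0≤1+2h (i≤j⇒0≤j-i a≤x+y) ⊕ 1≤a) 0 (solve (x ∷ y ∷ a ∷ b ∷ h ∷ p ∷ r ∷ [])))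
      where
      0≤a+b : 0ℤ ≤ a + b
      0≤a+b = linear (-b≤c ⊕ c<a) 1 (solve (a ∷ b ∷ c ∷ []))
      0≤a-b : 0ℤ ≤ a - b
      0≤a-b = linear (b≤c ⊕ c<a) 1 (solve (a ∷ b ∷ c ∷ []))

  square-rot : ∀ z → Square z → Square (rot z)
  square-rot (x + y i) (square p r p≤h -p≤h r≤h -r≤h re≡ im≡) = record
    { p = - r ; r = p ; p≤h = -r≤h ; -p≤h = subst (_≤ h) (sym (neg-involutive r)) r≤h ; r≤h = p≤h ; -r≤h = -p≤h
    ; re≡ = trans (neg-mul h y) (trans (cong -_ im≡) (re-eq p r a b))
    ; im≡ = trans re≡ (im-eq p r a b) }
    where
    neg-mul : ∀ h y → (1ℤ + (h + h)) * - y ≡ - ((1ℤ + (h + h)) * y)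
    neg-mul = solve-∀
    re-eq : ∀ p r a b → - (p * a + r * b) ≡ - r * b - p * a
    re-eq = solve-∀
    im-eq : ∀ p r a b → p * b - r * a ≡ - r * a + p * b
    im-eq = solve-∀

  square⇒oct : ∀ {z} → Square z → Oct m (a - 1ℤ) z
  square⇒oct = oct-coind Square square⇒half square-rot

  -- This rounds `α / β`: the coordinates of `α` times the conjugate of `β` are divided by the norm,
  -- and their centred remainders are `p` and `r`.
  reduce : ∀ α → ∃[ γ ] Square (α -ᵍ ((b + a i) *ᵍ γ))
  reduce (u + v i) with centred-remainder (u * b + v * a) h 0≤h | centred-remainder (v * b - u * a) h 0≤h
  ... | q , p≤h , -p≤h | q′ , r≤h , -r≤h = (q + q′ i) , record
    { p = _ ; r = _ ; p≤h = p≤h ; -p≤h = -p≤h ; r≤h = r≤h ; -r≤h = -r≤h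
    ; re≡ = subst (λ N → N * (u - (b * q - a * q′)) ≡ ((u * b + v * a) - q * N) * b - ((v * b - u * a) - q′ * N) * a)
        norm≡1+2h (re-eq u v a b q q′)
    ; im≡ = subst (λ N → N * (v - (b * q′ + a * q)) ≡ ((u * b + v * a) - q * N) * a + ((v * b - u * a) - q′ * N) * b)
        norm≡1+2h (im-eq u v a b q q′) }
    where
    re-eq : ∀ u v a b q q′ → (b * b + a * a) * (u - (b * q - a * q′))
      ≡ ((u * b + v * a) - q * (b * b + a * a)) * b - ((v * b - u * a) - q′ * (b * b + a * a)) * a
    re-eq = solve-∀
    im-eq : ∀ u v a b q q′ → (b * b + a * a) * (v - (b * q′ + a * q))
      ≡ ((u * b + v * a) - q * (b * b + a * a)) * a + ((v * b - u * a) - q′ * (b * b + a * a)) * b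
    im-eq = solve-∀

-- Covering the residue classes of an odd `β`.

Covered : ℕ → ℤ[i] → ℤ[i] → Set
Covered n β ζ = ∃[ m ] (G n m × ζ ≡ m [modᵍ β ])

rot-- : ∀ z z′ → rot z -ᵍ rot z′ ≡ rot (z -ᵍ z′)
rot-- (a + b i) (c + e i) = cong (_+ (a - c) i) (lemma b e)
  where
  lemma : ∀ b e → - b - - e ≡ - (b - e)
  lemma = solve-∀

covered-rot : ∀ n β ζ → Covered n β ζ → Covered n β (rot ζ)
covered-rot n β ζ (m , m∈G , γ , eq) = rot m , G-rot n m∈G , rot γ ,
  trans (rot-- ζ m) (trans (cong rot eq) (sym (*ᵍ-rot β γ)))

covered-unrot : ∀ n β ζ → Covered n β (rot ζ) → Covered n β ζ
covered-unrot n β ζ c = subst (Covered n β) (rot⁴ ζ)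
  (covered-rot n β (rot^ 3 ζ) (covered-rot n β (rot^ 2 ζ) (covered-rot n β (rot ζ) c)))

covered-translate : ∀ n β α γ → Covered n β (α -ᵍ (β *ᵍ γ)) → Covered n β α
covered-translate n (a + b i) (u + v i) (q + q′ i) ((m + m′ i) , m∈G , (s + s′ i) , eq) =
  (m + m′ i) , m∈G , ((q + s) + (q′ + s′) i) , cong₂ _+_i
    (trans (move u m (a * q - b * q′)) (trans (cong (_+ (a * q - b * q′)) (cong re eq)) (re-eq a b q q′ s s′)))
    (trans (move v m′ (a * q′ + b * q)) (trans (cong (_+ (a * q′ + b * q)) (cong im eq)) (im-eq a b q q′ s s′)))
  where
  move : ∀ u m t → u - m ≡ (u - t - m) + t
  move = solve-∀
  re-eq : ∀ a b q q′ s s′ → (a * s - b * s′) + (a * q - b * q′) ≡ a * (q + s) - b * (q′ + s′)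
  re-eq = solve-∀
  im-eq : ∀ a b q q′ s s′ → (a * s′ + b * s) + (a * q′ + b * q) ≡ a * (q′ + s′) + b * (q + s)
  im-eq = solve-∀

G⇒covered : ∀ n β {ζ} → G n ζ → Covered n β ζ
G⇒covered n (a + b i) {x + y i} g = (x + y i) , g , 0ᵍ ,
  cong₂ _+_i (re-eq x a b) (im-eq y a b)
  where
  re-eq : ∀ x a b → x - x ≡ a * 0ℤ - b * 0ℤ
  re-eq = solve-∀
  im-eq : ∀ y a b → y - y ≡ a * 0ℤ + b * 0ℤ
  im-eq = solve-∀

covered-by-β : ∀ n a b x y → G n ((x - b) + (y - a) i) → Covered n (b + a i) (x + y i)
covered-by-β n a b x y g = _ , g , 1ᵍ , cong₂ _+_i (re-eq a b x) (im-eq a b y)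
  where
  re-eq : ∀ a b x → x - (x - b) ≡ b * 1ℤ - a * 0ℤ
  re-eq = solve-∀
  im-eq : ∀ a b y → y - (y - a) ≡ b * 0ℤ + a * 1ℤ
  im-eq = solve-∀

covered-by--iβ : ∀ n a b x y → G n ((x - a) + (y + b) i) → Covered n (b + a i) (x + y i)
covered-by--iβ n a b x y g = _ , g , (0ℤ + -1ℤ i) , cong₂ _+_i (re-eq a b x) (im-eq a b y)
  where
  re-eq : ∀ a b x → x - (x - a) ≡ b * 0ℤ - a * -1ℤ
  re-eq = solve-∀
  im-eq : ∀ a b y → y - (y + b) ≡ b * -1ℤ + a * 0ℤ
  im-eq = solve-∀

covered-by-iβ : ∀ n a b x y → G n ((x + a) + (y - b) i) → Covered n (b + a i) (x + y i)
covered-by-iβ n a b x y g = _ , g , (0ℤ + 1ℤ i) , cong₂ _+_i (re-eq a b x) (im-eq a b y)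
  where
  re-eq : ∀ a b x → x - (x + a) ≡ b * 0ℤ - a * 1ℤ
  re-eq = solve-∀
  im-eq : ∀ a b y → y - (y - b) ≡ b * 1ℤ + a * 0ℤ
  im-eq = solve-∀

-- The coordinate sum of an odd point is odd, so the bound w (n + 1) - 2 improves to w (n + 1) - 3.
odd-relaxed-oct⇒G : ∀ n z → Odd z → Oct (w n - + 2) (w n + d n - + 2) z → G n z
odd-relaxed-oct⇒G n z z-odd o with n
-- At level 0 the relaxed diagonal bound is 2; parity lowers it to 1, which is the diamond `A₀`.
... | zero = small (oct11⇒A₀ (oct-odd {h = 1ℤ} z-odd o))
... | suc n′ = odd z-odd (subst (λ S → Oct (w (suc n′) - + 2) S z) (from-half h (w (suc (suc n′))) (proj₂ (w-even (suc n′))))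
  (oct-odd {h = h - 1ℤ} z-odd (subst (λ S → Oct (w (suc n′) - + 2) S z) to-half o)))
  where
  h : ℤ
  h = proj₁ (w-even (suc n′))
  shift : ∀ h → h + h - + 2 ≡ (h - 1ℤ) + (h - 1ℤ)
  shift = solve-∀
  to-half : w (suc n′) + d (suc n′) - + 2 ≡ (h - 1ℤ) + (h - 1ℤ)
  to-half = trans (cong (_- + 2) (trans (sym (w-suc (suc n′))) (proj₂ (w-even (suc n′))))) (shift h)
  from-half : ∀ h T → T ≡ h + h → (h - 1ℤ) + (h - 1ℤ) - 1ℤ ≡ T - + 3
  from-half h _ refl = solve (h ∷ [])

-- `c` is `|b|`, the bounds on `a` and `c + a` place `β` in the octagon for `n + 1`, and `m` is the
-- coordinate bound of the fundamental square.
module NormalisedCovering (n : ℕ) {a b c m k : ℤ} (|b|≡c : c ≡ b ⊎ c ≡ - b) (0≤c : 0ℤ ≤ c) (c<a : c ≤ a - 1ℤ)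
  (a≤ : a ≤ w n + d n - + 2) (c+a≤ : c + a ≤ w n + w n - + 3)
  (b+a≡1+2k : b + a ≡ 1ℤ + (k + k)) (a+c≡1+2m : a + c ≡ 1ℤ + (m + m)) where

  W D : ℤ
  W = w n
  D = d n
  β : ℤ[i]
  β = b + a i

  m≤W-2 : m ≤ W - + 2
  m≤W-2 = double-cancel-≤ (bound c a m W (≤-reflexive (sym a+c≡1+2m)) c+a≤)
    where
    bound : ∀ c a m W → 1ℤ + (m + m) ≤ a + c → c + a ≤ W + W - + 3 → m + m ≤ (W - + 2) + (W - + 2)
    bound c a m W p q = linear (p ⊕ q) 0 (solve (c ∷ a ∷ m ∷ W ∷ []))

  2y<c+a : ∀ {y} → y ≤ m → y + y ≤ c + a - 1ℤ
  2y<c+a {y} y≤m = linear (y≤m ⊕ y≤m ⊕ ≤-reflexive (sym a+c≡1+2m)) 0 (solve (y ∷ a ∷ c ∷ m ∷ []))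

  -- For even ζ, the shift of ζ by an odd multiple of β is odd.
  shifted : ∀ l x y x′ y′ j → x + y ≡ l + l → x′ + y′ ≡ (x + y) + (j + j) + (b + a) →
    Oct (W - + 2) (W + D - + 2) (x′ + y′ i) → G n (x′ + y′ i)
  shifted l x y x′ y′ j x+y≡2l eq = odd-relaxed-oct⇒G n (x′ + y′ i) (l + j + k ,
    trans eq (trans (cong₂ (λ s t → s + (j + j) + t) x+y≡2l b+a≡1+2k) (solve (l ∷ j ∷ k ∷ []))))

  deep⇒covered⁺ : ∀ l x y → x + y ≡ l + l → 0ℤ ≤ x → x ≤ y → x + y ≤ a - 1ℤ → y ≤ m →
    Deep W D x y → Covered n β (x + y i)
  deep⇒covered⁺ l x y x+y≡2l 0≤x x≤y x+y<a y≤m z-deep = by-sign |b|≡c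
    where
    by-sign : c ≡ b ⊎ c ≡ - b → Covered n β (x + y i)
    by-sign (inj₁ refl) = covered-by-β n a b x y (shifted l x y (x - b) (y - a) (- (b + a)) x+y≡2l
      (solve (x ∷ y ∷ a ∷ b ∷ []))
      (Shift.shift-β (1≤d n) (2d≤w n) a≤ 0≤x x≤y x+y<a z-deep 0≤c c<a c+a≤))
    by-sign (inj₂ refl) with Shift.shift-±β (1≤d n) (2d≤w n) a≤ 0≤x x≤y x+y<a z-deep 0≤c c<a c+a≤ (2y<c+a y≤m)
    ... | inj₁ o = covered-by-β n a b x y (shifted l x y (x - b) (y - a) (- (b + a)) x+y≡2l
      (solve (x ∷ y ∷ a ∷ b ∷ [])) o)
    ... | inj₂ o = covered-by--iβ n a b x y (shifted l x y (x - a) (y + b) (- a) x+y≡2l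
      (solve (x ∷ y ∷ a ∷ b ∷ [])) (subst (λ t → Oct (W - + 2) (W + D - + 2) ((x - a) + t i)) (cong (λ t → y + t) (neg-involutive b)) o))

  -- The mirror image of `deep⇒covered⁺`: reflection in the imaginary axis flips the sign of `b`, so
  -- the two cases swap and `- i β` takes the place of `i β` as the shift.
  deep⇒covered⁻ : ∀ l x y → x + y ≡ l + l → 0ℤ ≤ - x → - x ≤ y → - x + y ≤ a - 1ℤ → y ≤ m →
    Deep W D (- x) y → Covered n β (x + y i)
  deep⇒covered⁻ l x y x+y≡2l 0≤x x≤y x+y<a y≤m z-deep = by-sign |b|≡c
    where
    reflect : ∀ {t u} s → Oct (W - + 2) (W + D - + 2) (u + t i) → - u ≡ s → Oct (W - + 2) (W + D - + 2) (s + t i)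
    reflect _ o refl = oct-mirror _ o
    by-sign : c ≡ b ⊎ c ≡ - b → Covered n β (x + y i)
    by-sign (inj₂ refl) = covered-by-β n a b x y (shifted l x y (x - b) (y - a) (- (b + a)) x+y≡2l
      (solve (x ∷ y ∷ a ∷ b ∷ []))
      (reflect (x - b) (Shift.shift-β (1≤d n) (2d≤w n) a≤ 0≤x x≤y x+y<a z-deep 0≤c c<a c+a≤) (solve (x ∷ b ∷ []))))
    by-sign (inj₁ refl) with Shift.shift-±β (1≤d n) (2d≤w n) a≤ 0≤x x≤y x+y<a z-deep 0≤c c<a c+a≤ (2y<c+a y≤m)
    ... | inj₁ o = covered-by-β n a b x y (shifted l x y (x - b) (y - a) (- (b + a)) x+y≡2l
      (solve (x ∷ y ∷ a ∷ b ∷ [])) (reflect (x - b) o (solve (x ∷ b ∷ []))))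
    ... | inj₂ o = covered-by-iβ n a b x y (shifted l x y (x + a) (y - b) (- b) x+y≡2l
      (solve (x ∷ y ∷ a ∷ b ∷ [])) (reflect (x + a) o (solve (x ∷ a ∷ []))))

  -- Once `ζ` is rotated into the sector, an odd `ζ` represents itself. For an even one, `G⊎deep`,
  -- after a reflection if `x < 0`, either finds it in `G n` or licenses a shift.
  oct⇒covered : ∀ ζ → Oct m (a - 1ℤ) ζ → Covered n β ζ
  oct⇒covered = sector-induction (λ ζ → Oct m (a - 1ℤ) ζ → Covered n β ζ)
    (λ z h o → covered-unrot n β z (h (oct-rot o))) top
    where
    a-1≤ : a - 1ℤ ≤ W + D - + 2
    a-1≤ = bound a W D a≤
      where
      bound : ∀ a W D → a ≤ W + D - + 2 → a - 1ℤ ≤ W + D - + 2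
      bound a W D p = linear p 1 (solve (a ∷ W ∷ D ∷ []))
    top : ∀ x y → - y ≤ x → x ≤ y → Oct m (a - 1ℤ) (x + y i) → Covered n β (x + y i)
    top x y -y≤x x≤y o with parity (x + y)
    ... | inj₂ ζ-odd = G⇒covered n β (odd-relaxed-oct⇒G n (x + y i) ζ-odd (oct-mono m≤W-2 a-1≤ o))
    ... | inj₁ (l , x+y≡2l) with ≤⊎> 0ℤ x
    ... | inj₁ 0≤x with G⊎deep n x y 0≤x x≤y
    ... | inj₁ g = G⇒covered n β g
    ... | inj₂ z-deep = deep⇒covered⁺ l x y x+y≡2l 0≤x x≤y (Oct₈.x+y≤ o₈) (Oct₈.y≤ o₈) z-deep
      where o₈ = oct⇒oct₈ o
    top x y -y≤x x≤y o | inj₁ (l , x+y≡2l) | inj₂ x<0 with G⊎deep n (- x) y 0≤-x -x≤y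
      where
      0≤-x : 0ℤ ≤ - x
      0≤-x = linear x<0 1 (solve (x ∷ []))
      -x≤y : - x ≤ y
      -x≤y = linear -y≤x 0 (solve (x ∷ y ∷ []))
    ... | inj₁ g = G⇒covered n β (subst (G n) (cong (_+ y i) (neg-involutive x)) (G-mirror n _ g))
    ... | inj₂ z-deep = deep⇒covered⁻ l x y x+y≡2l (linear x<0 1 (solve (x ∷ [])))
      (linear -y≤x 0 (solve (x ∷ y ∷ []))) (Oct₈.y-x≤ o₈) (Oct₈.y≤ o₈) z-deep
      where o₈ = oct⇒oct₈ o

-- Rotation preserves the hypotheses and the ideal of `β`, so `β` may be taken in the sector. Each
-- class then has a point in the square, which is covered.
odd⇒↠ : ∀ n β → Odd β → Octₙ (suc n) β → G n ↠mod β
odd⇒↠ n = sector-induction (λ β → Odd β → Octₙ (suc n) β → G n ↠mod β)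
  (λ β h β-odd o → ↠-unrot β (h (odd-rot β β-odd) (oct-rot o))) top
  where
  top : ∀ b a → - a ≤ b → b ≤ a → Odd (b + a i) → Octₙ (suc n) (b + a i) → G n ↠mod (b + a i)
  top b a -a≤b b≤a (k , b+a≡1+2k) o = by-sign (≤⊎> 0ℤ b)
    where
    o₈ = oct⇒oct₈ o
    with-|b| : ∀ c m → c ≡ b ⊎ c ≡ - b → 0ℤ ≤ c → b ≤ c → - b ≤ c → c ≤ a → a + c ≡ 1ℤ + (m + m) →
      c + a ≤ w n + w n - + 3 → G n ↠mod (b + a i)
    with-|b| c m |b|≡c 0≤c b≤c -b≤c c≤a a+c≡1+2m c+a≤ α =
      let γ , s = FundamentalSquare.reduce {h = h} b≤c -b≤c c<a 1≤a 0≤m a+c≡1+2m (0≤h h norm≡1+2h) norm≡1+2h α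
      in covered-translate n (b + a i) α γ (NormalisedCovering.oct⇒covered n {k = k} |b|≡c 0≤c c<a
           (subst (λ t → a ≤ t - + 2) (w-suc n) (Oct₈.y≤ o₈)) c+a≤ b+a≡1+2k a+c≡1+2m _
           (FundamentalSquare.square⇒oct {h = h} b≤c -b≤c c<a 1≤a 0≤m a+c≡1+2m (0≤h h norm≡1+2h) norm≡1+2h s))
      where
      -- `c = a` would make `a + c` even.
      c<a : c ≤ a - 1ℤ
      c<a = ≤-by-contradiction λ a≤c → m+m≢1+n+n a m
        (subst (λ t → a + t ≡ 1ℤ + (m + m)) (≤-antisym c≤a (linear a≤c 0 (solve (a ∷ c ∷ [])))) a+c≡1+2m)
      1≤a : 1ℤ ≤ a
      1≤a = linear (0≤c ⊕ c<a) 0 (solve (a ∷ c ∷ []))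
      0≤m : 0ℤ ≤ m
      0≤m = double-cancel-≤ (linear (1≤a ⊕ 0≤c ⊕ ≤-reflexive a+c≡1+2m) 0 (solve (a ∷ c ∷ m ∷ [])))
      complete-square : ∀ a b → b * b + a * a ≡ (b + a) * (b + a) - (a * b + a * b)
      complete-square = solve-∀
      expand : ∀ k ab → (1ℤ + (k + k)) * (1ℤ + (k + k)) - (ab + ab)
        ≡ 1ℤ + ((k + k + (k * k + k * k) - ab) + (k + k + (k * k + k * k) - ab))
      expand = solve-∀
      h : ℤ
      -- Half of the norm minus 1, from `b² + a² = (b + a)² - 2 a b` and `b + a = 1 + 2 k`.
      h = k + k + (k * k + k * k) - a * b
      norm≡1+2h : b * b + a * a ≡ 1ℤ + (h + h)
      norm≡1+2h = trans (complete-square a b)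
        (trans (cong (λ t → t * t - (a * b + a * b)) b+a≡1+2k) (expand k (a * b)))
      0≤h : ∀ h → b * b + a * a ≡ 1ℤ + (h + h) → 0ℤ ≤ h
      0≤h h eq = double-cancel-≤ (linear (sq-mono (+≤+ z≤n) 1≤a ⊕ 0≤sq b ⊕ ≤-reflexive eq) 0 (solve (a ∷ b ∷ h ∷ [])))
    by-sign : 0ℤ ≤ b ⊎ 1ℤ + b ≤ 0ℤ → G n ↠mod (b + a i)
    by-sign (inj₁ 0≤b) = with-|b| b k (inj₁ refl) 0≤b ≤-refl (linear (0≤b ⊕ 0≤b) 0 (solve (b ∷ []))) b≤a
      (trans (+-comm a b) b+a≡1+2k) (Oct₈.x+y≤ o₈)
    by-sign (inj₂ b<0) = with-|b| (- b) (k - b) (inj₂ refl) (linear b<0 1 (solve (b ∷ [])))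
      (linear (b<0 ⊕ b<0) 2 (solve (b ∷ []))) ≤-refl (linear -a≤b 0 (solve (a ∷ b ∷ [])))
      (trans (move a b) (trans (cong (_- (b + b)) b+a≡1+2k) (solve (k ∷ b ∷ [])))) (Oct₈.y-x≤ o₈)
      where
      move : ∀ a b → a + - b ≡ (b + a) - (b + b)
      move = solve-∀

-- Equality of the Motzkin sets with the sets `G n`.

G⇒G⊎↠ : ∀ n β → G (suc n) β → G n β ⊎ G n ↠mod β
G⇒G⊎↠ n β (odd β-odd o) = inj₂ (odd⇒↠ n β β-odd o)
-- Here `η` is 0 or a unit. Modulo a unit, 0 alone represents everything, so the digits 0 and 1
-- suffice modulo `θ η`.
G⇒G⊎↠ zero _ (even η refl (small a)) with unit⇒↠ a
... | inj₁ refl = inj₁ (G-0 0)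
... | inj₂ h = inj₂ (↠-θ η h λ { _ refl → G-0 0 , small (is1 refl) })
G⇒G⊎↠ (suc n) _ (even η refl g) with G⇒G⊎↠ n η g
... | inj₁ g′ = inj₁ (even η refl g′)
... | inj₂ h = inj₂ (↠-θ η h (digit n))

Motzkin⇒G : ∀ n z → Motzkin n z → G n z
G⇒Motzkin : ∀ n z → G n z → Motzkin n z
Motzkin⇒G zero z a = small a
Motzkin⇒G (suc n) z (inj₁ m) = G-suc n (Motzkin⇒G n z m)
Motzkin⇒G (suc n) z (inj₂ h) = ↠⇒G n z λ α →
  let m , m∈M , eq = h α in m , Motzkin⇒G n m m∈M , eq
G⇒Motzkin zero z (small a) = a
G⇒Motzkin (suc n) z g with G⇒G⊎↠ n z g
... | inj₁ g′ = inj₁ (G⇒Motzkin n z g′)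
... | inj₂ h = inj₂ λ α → let m , m∈G , eq = h α in m , G⇒Motzkin n m m∈G , eq

-- Cardinalities

card-resp : ∀ {P Q : ℤ[i] → Set} {n} → (∀ z → P z → Q z) → (∀ z → Q z → P z) → HasCard P n → HasCard Q n
card-resp P⇒Q Q⇒P (xs , unique , ∈⇔ , len) =
  xs , unique , (λ z → mk⇔ (λ p → P⇒Q z (to (∈⇔ z) p)) (λ q → from (∈⇔ z) (Q⇒P z q))) , len

card-∅ : ∀ {P : ℤ[i] → Set} → (∀ z → ¬ P z) → HasCard P 0
card-∅ empty = [] , AllPairs.[] , (λ z → mk⇔ (λ ()) (λ p → contradiction p (empty z))) , refl

card-⊎ : ∀ {P Q : ℤ[i] → Set} {m n} → (∀ z → P z → ¬ Q z) →
  HasCard P m → HasCard Q n → HasCard (λ z → P z ⊎ Q z) (m +ℕ n)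
card-⊎ disjoint (xs , uxs , ∈xs , refl) (ys , uys , ∈ys , refl) =
  xs ++ ys , ++⁺ uxs uys (λ { (p , q) → disjoint _ (to (∈xs _) p) (to (∈ys _) q) }) ,
  (λ z → mk⇔
    (λ p → [ (λ q → inj₁ (to (∈xs z) q)) , (λ q → inj₂ (to (∈ys z) q)) ]′ (∈-++⁻ xs p))
    [ (λ p → ∈-++⁺ˡ (from (∈xs z) p)) , (λ q → ∈-++⁺ʳ xs (from (∈ys z) q)) ]′) ,
  length-++ xs

card-image : ∀ {P : ℤ[i] → Set} {n} (f : ℤ[i] → ℤ[i]) → (∀ {z z′} → f z ≡ f z′ → z ≡ z′) →
  HasCard P n → HasCard (λ z → ∃[ y ] (P y × z ≡ f y)) n
card-image f f-inj (xs , uxs , ∈xs , refl) = map f xs , map⁺ f-inj uxs ,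
  (λ z → mk⇔
    (λ p → let y , y∈xs , eq = ∈-map⁻ f p in y , to (∈xs y) y∈xs , eq)
    (λ { (y , py , refl) → ∈-map⁺ f (from (∈xs y) py) })) ,
  length-map f xs

Σ< : ℕ → (ℕ → ℕ) → ℕ
Σ< zero f = 0
Σ< (suc n) f = f n +ℕ Σ< n f

card-⋃ : ∀ {P : ℕ → ℤ[i] → Set} {f : ℕ → ℕ} → (∀ {j k z} → P j z → P k z → j ≡ k) →
  (∀ j → HasCard (P j) (f j)) → ∀ n → HasCard (λ z → ∃[ j ] (j < n × P j z)) (Σ< n f)
card-⋃ disjoint card zero = card-∅ λ { z (_ , () , _) }
card-⋃ {P} disjoint card (suc n) = card-resp
  (λ { z (inj₁ p) → n , ℕ.≤-refl , p ; z (inj₂ (j , j<n , p)) → j , ℕ.m≤n⇒m≤1+n j<n , p })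
  (λ { z (j , j<1+n , p) → split z j p (ℕ.m≤n⇒m<n∨m≡n (ℕ.m<1+n⇒m≤n j<1+n)) })
  (card-⊎ (λ { z p (j , j<n , q) → ℕ.<⇒≢ j<n (disjoint q p) }) (card n) (card-⋃ disjoint card n))
  where
  split : ∀ z j → P j z → j < n ⊎ j ≡ n → P n z ⊎ (∃[ k ] (k < n × P k z))
  split z j p (inj₁ j<n) = inj₂ (j , j<n , p)
  split z j p (inj₂ refl) = inj₁ p

-- Odd points of an octagon, counted along diagonals.

Segment : ℤ → ℤ → ℕ → ℤ[i] → Set
Segment s l c z = re z + im z ≡ s × l ≤ re z × 1ℤ + re z ≤ l + + c

card-segment : ∀ s l c → HasCard (Segment s l c) c
card-segment s l c = map point (upTo c) , map⁺ point-injective (upTo⁺ c) ,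
  (λ z → mk⇔ (λ p → let j , j∈ , eq = ∈-map⁻ point p in subst (Segment s l c) (sym eq) (sound j (∈-upTo⁻ j∈)))
             (complete z)) ,
  trans (length-map point (upTo c)) (length-upTo c)
  where
  point : ℕ → ℤ[i]
  point j = (l + + j) + (s - (l + + j)) i
  point-injective : ∀ {j k} → point j ≡ point k → j ≡ k
  point-injective {j} {k} eq = +-injective (+-cancelˡ l _ _ (cong re eq))
  sound : ∀ j → j < c → Segment s l c (point j)
  sound j j<c = sum (l + + j) s , i≤i+j l (+ j) , subst (_≤ l + + c) (assoc l (+ j)) (+-monoʳ-≤ l (+≤+ j<c))
    where
    sum : ∀ t s → t + (s - t) ≡ s
    sum = solve-∀
    assoc : ∀ l j → l + (1ℤ + j) ≡ 1ℤ + (l + j)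
    assoc = solve-∀
  complete : ∀ z → Segment s l c z → z ∈ map point (upTo c)
  complete (x + y i) (x+y≡s , l≤x , x<l+c) = subst (_∈ map point (upTo c)) (sym z≡)
    (∈-map⁺ point (∈-upTo⁺ (drop‿+≤+ (subst (λ t → 1ℤ + t ≤ + c) (sym j≡x-l) (bound x l (+ c) x<l+c)))))
    where
    j : ℕ
    j = ∣ x - l ∣
    j≡x-l : + j ≡ x - l
    j≡x-l = 0≤i⇒+∣i∣≡i (i≤j⇒0≤j-i l≤x)
    bound : ∀ x l c → 1ℤ + x ≤ l + c → 1ℤ + (x - l) ≤ c
    bound x l c p = linear p 0 (solve (x ∷ l ∷ c ∷ []))
    restore : ∀ x l → x ≡ l + (x - l)
    restore = solve-∀
    x≡ : x ≡ l + + j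
    x≡ = trans (restore x l) (cong (λ t → l + t) (sym j≡x-l))
    other : ∀ x y → y ≡ (x + y) - x
    other = solve-∀
    z≡ : x + y i ≡ point j
    z≡ = cong₂ _+_i x≡ (trans (other x y) (cong₂ _-_ x+y≡s x≡))

-- Half-open, so that its four rotated copies are disjoint and miss only the origin.
Quadrant : ℤ → ℤ → ℤ[i] → Set
Quadrant M S z = Odd z × Oct M S z × 1ℤ ≤ re z × 0ℤ ≤ im z

-- On a diagonal `x + y = 2 j + 1 < 2 m` only the axes cut, leaving `1 ≤ x ≤ 2 j + 1`.
short-row : ℕ → ℤ[i] → Set
short-row j = Segment (1ℤ + (+ j + + j)) 1ℤ (suc (j +ℕ j))

-- Beyond `2 m` the sides `x ≤ 2 m` and `y ≤ 2 m` cut the diagonal, leaving `2 j + 1 ≤ x ≤ 2 m`.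
long-row : ℕ → ℕ → ℤ[i] → Set
long-row m j = Segment (1ℤ + ((+ m + + j) + (+ m + + j))) (1ℤ + (+ j + + j)) ((m ∸ j) +ℕ (m ∸ j))

rows : ℕ → ℕ → ℕ
rows m e = Σ< m (λ j → suc (j +ℕ j)) +ℕ Σ< e (λ j → (m ∸ j) +ℕ (m ∸ j))

pos-∸ : ∀ {m n} → n ≤ℕ m → + (m ∸ n) ≡ + m - + n
pos-∸ {m} {n} n≤m = sym (trans (m-n≡m⊖n m n) (⊖-≥ n≤m))

1+2m-injective : ∀ {m n} → 1ℤ + (m + m) ≡ 1ℤ + (n + n) → m ≡ n
1+2m-injective eq = ≤-antisym (cancel (≤-reflexive eq)) (cancel (≤-reflexive (sym eq)))
  where
  cancel : ∀ {m n} → 1ℤ + (m + m) ≤ 1ℤ + (n + n) → m ≤ n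
  cancel {m} {n} p = double-cancel-≤ (linear p 0 (solve (m ∷ n ∷ [])))

-- The odd diagonals `2 k + 1 ≤ 2 m + 2 e - 1` are those with `k < m + e`, split at `k = m`. As
-- `j < e ≤ m`, the difference `m ∸ j` is not truncated.
card-quadrant : ∀ m e → e ≤ℕ m →
  HasCard (Quadrant (+ m + + m) (+ m + + m + (+ e + + e) - 1ℤ)) (rows m e)
card-quadrant m e e≤m = card-resp
  (λ { z (inj₁ (j , j<m , p)) → short⇒quadrant j z j<m p ; z (inj₂ (j , j<e , p)) → long⇒quadrant j z j<e p })
  quadrant⇒row
  (card-⊎ disjoint
    (card-⋃ {short-row} short-row-disjoint (λ j → card-segment (1ℤ + (+ j + + j)) 1ℤ (suc (j +ℕ j))) m)
    (card-⋃ {long-row m} long-row-disjoint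
      (λ j → card-segment (1ℤ + ((+ m + + j) + (+ m + + j))) (1ℤ + (+ j + + j)) ((m ∸ j) +ℕ (m ∸ j))) e))
  where
  M S : ℤ
  M = + m + + m
  S = M + (+ e + + e) - 1ℤ
  short-row-disjoint : ∀ {j k z} → short-row j z → short-row k z → j ≡ k
  short-row-disjoint {j} {k} (p , _) (q , _) = +-injective (1+2m-injective {+ j} {+ k} (trans (sym p) q))
  long-row-disjoint : ∀ {j k z} → long-row m j z → long-row m k z → j ≡ k
  long-row-disjoint {j} {k} (p , _) (q , _) =
    +-injective (+-cancelˡ (+ m) _ _ (1+2m-injective {+ m + + j} {+ m + + k} (trans (sym p) q)))
  disjoint : ∀ z → (∃[ j ] (j < m × short-row j z)) → ¬ (∃[ j ] (j < e × long-row m j z))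
  disjoint z (j , j<m , p , _) (k , _ , q , _) =
    ℕ.<⇒≱ j<m (subst (m ≤ℕ_) (sym (+-injective (1+2m-injective {+ j} {+ m + + k} (trans (sym p) q)))) (ℕ.m≤m+n m k))
  short⇒quadrant : ∀ j z → j < m → short-row j z → Quadrant M S z
  short⇒quadrant j (x + y i) j<m (x+y≡ , 1≤x , x<) =
    (+ j , x+y≡) , bounds (+ m) (+ e) (+ j) (+≤+ j<m) (+≤+ z≤n) x+y≡ 1≤x x<
    where
    bounds : ∀ m e j → 1ℤ + j ≤ m → 0ℤ ≤ e → x + y ≡ 1ℤ + (j + j) → 1ℤ ≤ x → 1ℤ + x ≤ 1ℤ + (1ℤ + (j + j)) →
      Oct (m + m) (m + m + (e + e) - 1ℤ) (x + y i) × 1ℤ ≤ x × 0ℤ ≤ y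
    bounds m e j j<m 0≤e x+y≡ 1≤x x< = oct-quadrant (≤-trans (+≤+ z≤n) 1≤x) 0≤y
      (linear (x< ⊕ j<m ⊕ j<m) 1 (solve (x ∷ j ∷ m ∷ [])))
      (linear (≤-reflexive x+y≡ ⊕ 1≤x ⊕ j<m ⊕ j<m) 2 (solve (x ∷ y ∷ j ∷ m ∷ [])))
      (linear (≤-reflexive x+y≡ ⊕ j<m ⊕ j<m ⊕ 0≤e ⊕ 0≤e) 0 (solve (x ∷ y ∷ j ∷ m ∷ e ∷ []))) , 1≤x , 0≤y
      where
      0≤y : 0ℤ ≤ y
      0≤y = linear (≤-reflexive (sym x+y≡) ⊕ x<) 0 (solve (x ∷ y ∷ j ∷ []))
  long⇒quadrant : ∀ j z → j < e → long-row m j z → Quadrant M S z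
  long⇒quadrant j (x + y i) j<e (x+y≡ , l≤x , x<) =
    (+ m + + j , x+y≡) , bounds (+ m) (+ e) (+ j) (+≤+ j<e) (+≤+ z≤n) x+y≡ l≤x
      (subst (λ t → 1ℤ + x ≤ 1ℤ + (+ j + + j) + (t + t)) (pos-∸ (ℕ.≤-trans (ℕ.<⇒≤ j<e) e≤m)) x<)
    where
    bounds : ∀ m e j → 1ℤ + j ≤ e → 0ℤ ≤ j → x + y ≡ 1ℤ + ((m + j) + (m + j)) → 1ℤ + (j + j) ≤ x →
      1ℤ + x ≤ 1ℤ + (j + j) + ((m - j) + (m - j)) →
      Oct (m + m) (m + m + (e + e) - 1ℤ) (x + y i) × 1ℤ ≤ x × 0ℤ ≤ y
    bounds m e j j<e 0≤j x+y≡ l≤x x< = oct-quadrant (≤-trans (+≤+ z≤n) 1≤x) 0≤y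
      (linear x< 0 (solve (x ∷ j ∷ m ∷ [])))
      (linear (≤-reflexive x+y≡ ⊕ l≤x) 0 (solve (x ∷ y ∷ j ∷ m ∷ [])))
      (linear (≤-reflexive x+y≡ ⊕ j<e ⊕ j<e) 0 (solve (x ∷ y ∷ j ∷ m ∷ e ∷ []))) , 1≤x , 0≤y
      where
      1≤x : 1ℤ ≤ x
      1≤x = linear (l≤x ⊕ 0≤j ⊕ 0≤j) 0 (solve (x ∷ j ∷ []))
      0≤y : 0ℤ ≤ y
      0≤y = linear (≤-reflexive (sym x+y≡) ⊕ x< ⊕ 0≤j ⊕ 0≤j) 1 (solve (x ∷ y ∷ j ∷ m ∷ []))
  quadrant⇒row : ∀ z → Quadrant M S z → (∃[ j ] (j < m × short-row j z)) ⊎ (∃[ j ] (j < e × long-row m j z))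
  quadrant⇒row (x + y i) ((k , x+y≡) , o , 1≤x , 0≤y) with ≤⊎> (1ℤ + k) (+ m)
  ... | inj₁ k<m = inj₁ (j , drop‿+≤+ (subst (λ t → 1ℤ + t ≤ + m) (sym j≡k) k<m) ,
      subst (λ t → x + y ≡ 1ℤ + (t + t)) (sym j≡k) x+y≡ , 1≤x ,
      subst (λ t → 1ℤ + x ≤ 1ℤ + (1ℤ + (t + t))) (sym j≡k)
        (linear (≤-reflexive x+y≡ ⊕ 0≤y) 0 (solve (x ∷ y ∷ k ∷ []))))
    where
    0≤k : 0ℤ ≤ k
    0≤k = double-cancel-≤ (linear (≤-reflexive x+y≡ ⊕ 1≤x ⊕ 0≤y) 0 (solve (x ∷ y ∷ k ∷ [])))
    j : ℕ
    j = ∣ k ∣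
    j≡k : + j ≡ k
    j≡k = 0≤i⇒+∣i∣≡i 0≤k
  ... | inj₂ m≤k = inj₂ (j , j<e ,
      trans x+y≡ (cong (λ t → 1ℤ + (t + t)) k≡m+j) ,
      lower (+ m) (+ j) (Oct₈.y≤ o₈) x+y≡m+j ,
      subst (λ t → 1ℤ + x ≤ 1ℤ + (+ j + + j) + (t + t)) (sym (pos-∸ (ℕ.≤-trans (ℕ.<⇒≤ j<e) e≤m)))
        (upper (+ m) (+ j) (Oct₈.x≤ o₈)))
    where
    o₈ = oct⇒oct₈ o
    j : ℕ
    j = ∣ k - + m ∣
    0≤k-m : ∀ m → 1ℤ + m ≤ 1ℤ + k → 0ℤ ≤ k - m
    0≤k-m m p = linear p 0 (solve (k ∷ m ∷ []))
    j≡k-m : + j ≡ k - + m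
    j≡k-m = 0≤i⇒+∣i∣≡i (0≤k-m (+ m) m≤k)
    restore : ∀ k m → k ≡ m + (k - m)
    restore = solve-∀
    k≡m+j : k ≡ + m + + j
    k≡m+j = trans (restore k (+ m)) (cong (λ t → + m + t) (sym j≡k-m))
    x+y≡m+j : x + y ≡ 1ℤ + ((+ m + + j) + (+ m + + j))
    x+y≡m+j = trans x+y≡ (cong (λ t → 1ℤ + (t + t)) k≡m+j)
    upper : ∀ m j → x ≤ m + m → 1ℤ + x ≤ 1ℤ + (j + j) + ((m - j) + (m - j))
    upper m j p = linear p 0 (solve (x ∷ m ∷ j ∷ []))
    lower : ∀ m j → y ≤ m + m → x + y ≡ 1ℤ + ((m + j) + (m + j)) → 1ℤ + (j + j) ≤ x
    lower m j p q = linear (p ⊕ ≤-reflexive (sym q)) 0 (solve (x ∷ y ∷ m ∷ j ∷ []))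
    below : ∀ m e j → x + y ≡ 1ℤ + ((m + j) + (m + j)) → x + y ≤ m + m + (e + e) - 1ℤ → 1ℤ + j ≤ e
    below m e j p q = double-cancel-≤ (linear (≤-reflexive (sym p) ⊕ q) 0 (solve (x ∷ y ∷ m ∷ e ∷ j ∷ [])))
    j<e : j < e
    j<e = drop‿+≤+ (below (+ m) (+ e) (+ j) x+y≡m+j (Oct₈.x+y≤ o₈))

rot-injective : ∀ {z z′} → rot z ≡ rot z′ → z ≡ z′
rot-injective {z} {z′} eq = trans (sym (rot⁴ z)) (trans (cong (rot^ 3) eq) (rot⁴ z′))

card-rot : ∀ {P : ℤ[i] → Set} {n} → HasCard P n → HasCard (λ z → P (rot z)) n
card-rot {P} c = card-resp
  (λ { z (y , py , refl) → subst P (sym (rot⁴ y)) py })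
  (λ z p → rot z , p , sym (rot⁴ z))
  (card-image (rot^ 3) (λ eq → rot-injective (rot-injective (rot-injective eq))) c)

card-oct : ∀ m e → e ≤ℕ m →
  HasCard (λ z → Odd z × Oct (+ m + + m) (+ m + + m + (+ e + + e) - 1ℤ) z)
    (rows m e +ℕ (rows m e +ℕ (rows m e +ℕ rows m e)))
card-oct m e e≤m = card-resp merge split
  (card-⊎ d₀ c₀ (card-⊎ d₁ c₁ (card-⊎ d₂ (card-rot c₁) (card-rot (card-rot c₁)))))
  where
  Q : ℤ[i] → Set
  Q = Quadrant (+ m + + m) (+ m + + m + (+ e + + e) - 1ℤ)
  c₀ : HasCard Q (rows m e)
  c₀ = card-quadrant m e e≤m
  c₁ : HasCard (λ z → Q (rot z)) (rows m e)
  c₁ = card-rot c₀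
  clash : ∀ {t} → 1ℤ ≤ - t → ¬ (0ℤ ≤ t)
  clash {t} p q = 1≰0 (linear (p ⊕ q) 0 (solve (t ∷ [])))
  clash′ : ∀ {t} → 1ℤ ≤ t → ¬ (0ℤ ≤ - t)
  clash′ {t} p q = 1≰0 (linear (p ⊕ q) 0 (solve (t ∷ [])))
  d₂ : ∀ z → Q (rot (rot z)) → ¬ Q (rot (rot (rot z)))
  d₂ (x + y i) (_ , _ , _ , 0≤-y) (_ , _ , 1≤--y , _) = clash 1≤--y 0≤-y
  d₁ : ∀ z → Q (rot z) → ¬ (Q (rot (rot z)) ⊎ Q (rot (rot (rot z))))
  d₁ (x + y i) (_ , _ , _ , 0≤x) (inj₁ (_ , _ , 1≤-x , _)) = clash 1≤-x 0≤x
  d₁ (x + y i) (_ , _ , 1≤-y , _) (inj₂ (_ , _ , 1≤--y , _)) = clash 1≤--y (≤-trans (+≤+ z≤n) 1≤-y)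
  d₀ : ∀ z → Q z → ¬ (Q (rot z) ⊎ Q (rot (rot z)) ⊎ Q (rot (rot (rot z))))
  d₀ (x + y i) (_ , _ , _ , 0≤y) (inj₁ (_ , _ , 1≤-y , _)) = clash 1≤-y 0≤y
  d₀ (x + y i) (_ , _ , 1≤x , _) (inj₂ (inj₁ (_ , _ , 1≤-x , _))) = clash 1≤-x (≤-trans (+≤+ z≤n) 1≤x)
  d₀ (x + y i) (_ , _ , 1≤x , _) (inj₂ (inj₂ (_ , _ , _ , 0≤-x))) = clash′ 1≤x 0≤-x
  Odd×Oct : ℤ[i] → Set
  Odd×Oct z = Odd z × Oct (+ m + + m) (+ m + + m + (+ e + + e) - 1ℤ) z
  rotate : ∀ z → Odd×Oct z → Odd×Oct (rot z)
  rotate z (z-odd , o) = odd-rot z z-odd , oct-rot o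
  unrotate : ∀ z → Odd×Oct (rot z) → Odd×Oct z
  unrotate z (z-odd , o) = subst Odd (rot⁴ z) (odd-rot (rot^ 3 z) (odd-rot (rot^ 2 z) (odd-rot (rot z) z-odd))) , oct-unrot o
  forget : ∀ z → Q z → Odd×Oct z
  forget z (z-odd , o , _) = z-odd , o
  merge : ∀ z → Q z ⊎ Q (rot z) ⊎ Q (rot (rot z)) ⊎ Q (rot (rot (rot z))) → Odd×Oct z
  merge z (inj₁ q) = forget z q
  merge z (inj₂ (inj₁ q)) = unrotate z (forget _ q)
  merge z (inj₂ (inj₂ (inj₁ q))) = unrotate z (unrotate (rot z) (forget _ q))
  merge z (inj₂ (inj₂ (inj₂ q))) = unrotate z (unrotate (rot z) (unrotate (rot (rot z)) (forget _ q)))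
  remember : ∀ z → Odd×Oct z → 1ℤ ≤ re z → 0ℤ ≤ im z → Q z
  remember z (z-odd , o) p q = z-odd , o , p , q
  split : ∀ z → Odd×Oct z → Q z ⊎ Q (rot z) ⊎ Q (rot (rot z)) ⊎ Q (rot (rot (rot z)))
  split (x + y i) p with ≤⊎> x 0ℤ | ≤⊎> y 0ℤ | ≤⊎> 0ℤ x | ≤⊎> 0ℤ y
  ... | inj₂ 0<x | _ | _ | inj₁ 0≤y = inj₁ (remember _ p 0<x 0≤y)
  ... | _ | _ | inj₁ 0≤x | inj₂ y<0 = inj₂ (inj₁ (remember _ (rotate _ p) (linear y<0 0 (solve (y ∷ []))) 0≤x))
  ... | _ | inj₁ y≤0 | inj₂ x<0 | _ = inj₂ (inj₂ (inj₁ (remember _ (rotate _ (rotate _ p))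
        (linear x<0 0 (solve (x ∷ []))) (linear y≤0 0 (solve (y ∷ []))))))
  ... | inj₁ x≤0 | inj₂ 0<y | _ | _ = inj₂ (inj₂ (inj₂ (remember _ (rotate _ (rotate _ (rotate _ p)))
        (linear 0<y 0 (solve (y ∷ []))) (linear x≤0 0 (solve (x ∷ []))))))
  ... | inj₂ _ | inj₂ 0<y | inj₂ _ | inj₂ y<0 = contradiction (linear (0<y ⊕ y<0) 1 (solve (y ∷ []))) 1≰0
  -- Only the origin escapes all four quadrants, and it is not odd.
  ... | inj₁ x≤0 | inj₁ y≤0 | inj₁ 0≤x | inj₁ 0≤y = contradiction (cong₂ _+_i (≤-antisym x≤0 0≤x) (≤-antisym y≤0 0≤y)) (odd⇒≢0 (proj₁ p))

-- w (n + 1) = 2 μ n + 2 and d (n + 1) = 2 e n.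
μ e : ℕ → ℕ
μ 0 = 1
μ 1 = 2
μ (suc (suc n)) = suc (μ n +ℕ μ n)
e 0 = 1
e 1 = 1
e (suc (suc n)) = e n +ℕ e n

e≤μ : ∀ n → e n ≤ℕ μ n
e≤μ 0 = ℕ.≤-refl
e≤μ 1 = s≤s z≤n
e≤μ (suc (suc n)) = ℕ.m≤n⇒m≤1+n (ℕ.+-mono-≤ (e≤μ n) (e≤μ n))

w≡2μ+2 : ∀ n → w (suc n) ≡ (+ μ n + + μ n) + + 2
w≡2μ+2 0 = refl
w≡2μ+2 1 = refl
w≡2μ+2 (suc (suc n)) = trans (cong₂ _+_ (w≡2μ+2 n) (w≡2μ+2 n)) (lemma (+ μ n))
  where
  lemma : ∀ m → (m + m + + 2) + (m + m + + 2) ≡ (1ℤ + (m + m)) + (1ℤ + (m + m)) + + 2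
  lemma = solve-∀

d≡2e : ∀ n → d (suc n) ≡ + e n + + e n
d≡2e 0 = refl
d≡2e 1 = refl
d≡2e (suc (suc n)) = cong₂ _+_ (d≡2e n) (d≡2e n)

odds : ℕ → ℕ
odds n = let r = rows (μ n) (e n) in r +ℕ (r +ℕ (r +ℕ r))

cardG : ℕ → ℕ
cardG zero = 5
cardG (suc n) = odds n +ℕ cardG n

card-A₀ : HasCard A₀ 5
card-A₀ = card-resp (λ z p → p) (λ z p → p)
  (card-⊎ (λ { _ refl (inj₁ ()) ; _ refl (inj₂ (inj₁ ())) ; _ refl (inj₂ (inj₂ (inj₁ ()))) ; _ refl (inj₂ (inj₂ (inj₂ ()))) })
    (card-point _) (card-⊎ (λ { _ refl (inj₁ ()) ; _ refl (inj₂ (inj₁ ())) ; _ refl (inj₂ (inj₂ ())) })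
      (card-point _) (card-⊎ (λ { _ refl (inj₁ ()) ; _ refl (inj₂ ()) })
        (card-point _) (card-⊎ (λ { _ refl () }) (card-point _) (card-point _)))))
  where
  card-point : ∀ a → HasCard (_≡ a) 1
  card-point a = a ∷ [] , All.[] AllPairs.∷ AllPairs.[] ,
    (λ z → mk⇔ (λ { (here p) → p ; (there ()) }) here) , refl

card-odd : ∀ n → HasCard (λ z → Odd z × Octₙ (suc n) z) (odds n)
card-odd n = subst₂ (λ M S → HasCard (λ z → Odd z × Oct M S z) (odds n)) M≡ S≡ (card-oct (μ n) (e n) (e≤μ n))
  where
  shift : ∀ t → t ≡ t + + 2 - + 2
  shift = solve-∀
  shift′ : ∀ t f → t + f - 1ℤ ≡ (t + + 2) + f - + 3
  shift′ = solve-∀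
  M≡ : + μ n + + μ n ≡ w (suc n) - + 2
  M≡ = trans (shift (+ μ n + + μ n)) (cong (_- + 2) (sym (w≡2μ+2 n)))
  S≡ : + μ n + + μ n + (+ e n + + e n) - 1ℤ ≡ w (suc (suc n)) - + 3
  S≡ = trans (shift′ (+ μ n + + μ n) (+ e n + + e n))
    (trans (cong₂ (λ s t → s + t - + 3) (sym (w≡2μ+2 n)) (sym (d≡2e n))) (cong (_- + 3) (sym (w-suc (suc n)))))

card-G : ∀ n → HasCard (G n) (cardG n)
card-G zero = card-resp (λ z a → small a) (λ { z (small a) → a }) card-A₀
card-G (suc n) = card-resp
  (λ { z (inj₁ (z-odd , o)) → odd z-odd o ; z (inj₂ (η , g , eq)) → even η eq g })
  (λ { z (odd z-odd o) → inj₁ (z-odd , o) ; z (even η eq g) → inj₂ (η , g , eq) })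
  (card-⊎ (λ { z (z-odd , _) (η , _ , refl) → odd-θ η z-odd })
    (card-odd n) (card-image θ θ-injective (card-G n)))

-- Closed formulas.

Σ-odd : ∀ n → + Σ< n (λ j → suc (j +ℕ j)) ≡ + n * + n
Σ-odd zero = refl
Σ-odd (suc n) = trans (cong (λ t → 1ℤ + (+ n + + n) + t) (Σ-odd n)) (lemma (+ n))
  where
  lemma : ∀ n → 1ℤ + (n + n) + n * n ≡ (1ℤ + n) * (1ℤ + n)
  lemma = solve-∀

Σ-even : ∀ m n → n ≤ℕ m →
  + Σ< n (λ j → (m ∸ j) +ℕ (m ∸ j)) ≡ + n * (+ m + + m + 1ℤ - + n)
Σ-even m zero _ = refl
Σ-even m (suc n) n<m = trans (cong₂ (λ s t → (s + s) + t) (pos-∸ (ℕ.<⇒≤ n<m)) (Σ-even m n (ℕ.<⇒≤ n<m))) (lemma (+ m) (+ n))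
  where
  lemma : ∀ m n → ((m - n) + (m - n)) + n * (m + m + 1ℤ - n) ≡ (1ℤ + n) * (m + m + 1ℤ - (1ℤ + n))
  lemma = solve-∀

rows-formula : ∀ m n → n ≤ℕ m → + rows m n ≡ + m * + m + + n * (+ m + + m + 1ℤ - + n)
rows-formula m n n≤m = cong₂ _+_ (Σ-odd m) (Σ-even m n n≤m)

-- `twice (suc k)` reduces to two successors, matching the two-step recursion of `μ` and `e`.
twice : ℕ → ℕ
twice zero = 0
twice (suc k) = suc (suc (twice k))

2*≡twice : ∀ k → 2 *ℕ k ≡ twice k
2*≡twice zero = refl
2*≡twice (suc k) = cong suc (trans (ℕ.+-suc k (k +ℕ 0)) (cong suc (2*≡twice k)))

2^ : ℕ → ℤ
2^ k = (+ 2) ^ k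

4^≡ : ∀ k → (+ 4) ^ k ≡ 2^ k * 2^ k
4^≡ zero = refl
4^≡ (suc k) = trans (cong (+ 4 *_) (4^≡ k)) (lemma (2^ k))
  where
  lemma : ∀ t → + 4 * (t * t) ≡ (+ 2 * t) * (+ 2 * t)
  lemma = solve-∀

double : ∀ t → t + t ≡ + 2 * t
double = solve-∀

e-twice : ∀ k → + e (twice k) ≡ 2^ k
e-twice zero = refl
e-twice (suc k) = trans (cong₂ _+_ (e-twice k) (e-twice k)) (double (2^ k))

e-suc-twice : ∀ k → + e (suc (twice k)) ≡ 2^ k
e-suc-twice zero = refl
e-suc-twice (suc k) = trans (cong₂ _+_ (e-suc-twice k) (e-suc-twice k)) (double (2^ k))

μ-twice : ∀ k → + μ (twice k) ≡ + 2 * 2^ k - 1ℤ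
μ-twice zero = refl
μ-twice (suc k) = trans (cong (λ t → 1ℤ + (t + t)) (μ-twice k)) (lemma (2^ k))
  where
  lemma : ∀ t → 1ℤ + ((+ 2 * t - 1ℤ) + (+ 2 * t - 1ℤ)) ≡ + 2 * (+ 2 * t) - 1ℤ
  lemma = solve-∀

μ-suc-twice : ∀ k → + μ (suc (twice k)) ≡ + 3 * 2^ k - 1ℤ
μ-suc-twice zero = refl
μ-suc-twice (suc k) = trans (cong (λ t → 1ℤ + (t + t)) (μ-suc-twice k)) (lemma (2^ k))
  where
  lemma : ∀ t → 1ℤ + ((+ 3 * t - 1ℤ) + (+ 3 * t - 1ℤ)) ≡ + 3 * (+ 2 * t) - 1ℤ
  lemma = solve-∀

odds-formula : ∀ n → + odds n ≡ + 4 * (+ μ n * + μ n + + e n * (+ μ n + + μ n + 1ℤ - + e n))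
odds-formula n = trans (cong (λ r → r + (r + (r + r))) (rows-formula (μ n) (e n) (e≤μ n))) (quadruple _)
  where
  quadruple : ∀ r → r + (r + (r + r)) ≡ + 4 * r
  quadruple = solve-∀

odds-twice : ∀ k → + odds (twice k) ≡ + 28 * (2^ k * 2^ k) - + 20 * 2^ k + + 4
odds-twice k = trans (odds-formula (twice k))
  (trans (cong₂ (λ m n → + 4 * (m * m + n * (m + m + 1ℤ - n))) (μ-twice k) (e-twice k)) (lemma (2^ k)))
  where
  lemma : ∀ t → + 4 * ((+ 2 * t - 1ℤ) * (+ 2 * t - 1ℤ) + t * ((+ 2 * t - 1ℤ) + (+ 2 * t - 1ℤ) + 1ℤ - t))
    ≡ + 28 * (t * t) - + 20 * t + + 4
  lemma = solve-∀

odds-suc-twice : ∀ k → + odds (suc (twice k)) ≡ + 56 * (2^ k * 2^ k) - + 28 * 2^ k + + 4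
odds-suc-twice k = trans (odds-formula (suc (twice k)))
  (trans (cong₂ (λ m n → + 4 * (m * m + n * (m + m + 1ℤ - n))) (μ-suc-twice k) (e-suc-twice k)) (lemma (2^ k)))
  where
  lemma : ∀ t → + 4 * ((+ 3 * t - 1ℤ) * (+ 3 * t - 1ℤ) + t * ((+ 3 * t - 1ℤ) + (+ 3 * t - 1ℤ) + 1ℤ - t))
    ≡ + 56 * (t * t) - + 28 * t + + 4
  lemma = solve-∀

-- One layer of odd points is added per level, alternating between the parities; the constants 4 of
-- two successive layers produce the term `8 k`.
cardG-odd : ∀ k → + cardG (suc (twice k)) ≡ + 56 * (2^ k * 2^ k) - + 68 * 2^ k + + 8 * + k + + 29
cardG-even : ∀ k → + cardG (suc (suc (twice k))) ≡ + 112 * (2^ k * 2^ k) - + 96 * 2^ k + + 8 * + k + + 33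
cardG-odd zero = refl
cardG-odd (suc k) = trans (cong₂ _+_ (odds-twice (suc k)) (cardG-even k)) (lemma (2^ k) (+ k))
  where
  lemma : ∀ t k → (+ 28 * ((+ 2 * t) * (+ 2 * t)) - + 20 * (+ 2 * t) + + 4) + (+ 112 * (t * t) - + 96 * t + + 8 * k + + 33)
    ≡ + 56 * ((+ 2 * t) * (+ 2 * t)) - + 68 * (+ 2 * t) + + 8 * (1ℤ + k) + + 29
  lemma = solve-∀
cardG-even k = trans (cong₂ _+_ (odds-suc-twice k) (cardG-odd k)) (lemma (2^ k) (+ k))
  where
  lemma : ∀ t k → (+ 56 * (t * t) - + 28 * t + + 4) + (+ 56 * (t * t) - + 68 * t + + 8 * k + + 29)
    ≡ + 112 * (t * t) - + 96 * t + + 8 * k + + 33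
  lemma = solve-∀

card-Motzkin : ∀ n → HasCard (Motzkin n) (cardG n)
card-Motzkin n = card-resp (G⇒Motzkin n) (Motzkin⇒G n) (card-G n)

theorem4p3 : ((k : ℕ) → ∃[ n ] (HasCard (Motzkin (2 *ℕ k +ℕ 1)) n
    × (+ n) ≡ (+ 14) * (+ 4) ^ (k +ℕ 1) - (+ 34) * (+ 2) ^ (k +ℕ 1) + (+ 8) * (+ k) + (+ 29)))
    × ((k : ℕ) → k ≥ 1 → ∃[ n ] (HasCard (Motzkin (2 *ℕ k)) n
    × (+ n) ≡ (+ 28) * (+ 4) ^ k - (+ 48) * (+ 2) ^ k + (+ 8) * (+ k) + (+ 25)))
theorem4p3 = odd-case , even-case
  where
  odd-index : ∀ k → suc (twice k) ≡ 2 *ℕ k +ℕ 1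
  odd-index k = sym (trans (ℕ.+-comm (2 *ℕ k) 1) (cong suc (2*≡twice k)))
  -- With `t = 2ᵏ`, the powers in the claim are `4ᵏ⁺¹ = 4 t²` and `2ᵏ⁺¹ = 2 t`.
  odd-formula : ∀ t k → + 56 * (t * t) - + 68 * t + + 8 * k + + 29
    ≡ + 14 * (+ 4 * (t * t)) - + 34 * (+ 2 * t) + + 8 * k + + 29
  odd-formula = solve-∀
  -- The even claim is used at `k + 1`, so its constant 25 becomes 33.
  even-formula : ∀ t k → + 112 * (t * t) - + 96 * t + + 8 * k + + 33
    ≡ + 28 * (+ 4 * (t * t)) - + 48 * (+ 2 * t) + + 8 * (1ℤ + k) + + 25
  even-formula = solve-∀
  odd-case : (k : ℕ) → ∃[ n ] (HasCard (Motzkin (2 *ℕ k +ℕ 1)) n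
    × (+ n) ≡ (+ 14) * (+ 4) ^ (k +ℕ 1) - (+ 34) * (+ 2) ^ (k +ℕ 1) + (+ 8) * (+ k) + (+ 29))
  odd-case k = cardG (suc (twice k)) ,
    subst (λ n → HasCard (Motzkin n) (cardG (suc (twice k)))) (odd-index k) (card-Motzkin (suc (twice k))) ,
    trans (cardG-odd k) (trans (odd-formula (2^ k) (+ k)) (trans
      (cong (λ f → + 14 * (+ 4 * f) - + 34 * 2^ (suc k) + + 8 * + k + + 29) (sym (4^≡ k)))
      (cong (λ j → + 14 * (+ 4) ^ j - + 34 * 2^ j + + 8 * + k + + 29) (ℕ.+-comm 1 k))))
  even-case : (k : ℕ) → k ≥ 1 → ∃[ n ] (HasCard (Motzkin (2 *ℕ k)) n
    × (+ n) ≡ (+ 28) * (+ 4) ^ k - (+ 48) * (+ 2) ^ k + (+ 8) * (+ k) + (+ 25))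
  even-case (suc k) _ = cardG (twice (suc k)) ,
    subst (λ n → HasCard (Motzkin n) (cardG (twice (suc k)))) (sym (2*≡twice (suc k))) (card-Motzkin (twice (suc k))) ,
    trans (cardG-even k) (trans (even-formula (2^ k) (+ k))
      (cong (λ f → + 28 * (+ 4 * f) - + 48 * 2^ (suc k) + + 8 * + suc k + + 25) (sym (4^≡ k))))
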